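{- Let $p$ be a prime number and let $r$ be a natural number. If the elementary abelian group $(\mathbb{Z}_p)^r$ is not a DCI group, then $(\mathbb{Z}_p)^{r+3}$ is not a CI group.
   Context: Let $G$ be a finite group. For a subset $S \subseteq G$, the Cayley digraph $\overrightarrow{\mathrm{Cay}}(G;S)$ is the directed graph with vertex set $G$ and with a directed edge $g \to h$ if and only if $h \in Sg$ (loops are allowed, i.e. $S$ may contain the identity). If $S = S^{ -1}$ ($S$ is symmetric), it can be viewed as an undirected graph, called a Cayley graph and denoted $\mathrm{Cay}(G;S)$. A Cayley digraph $\overrightarrow{\mathrm{Cay}}(G;S)$ is a DCI digraph if, for every subset $S'$ of $G$ such that $\overrightarrow{\mathrm{Cay}}(G;S) \cong \overrightarrow{\mathrm{Cay}}(G;S')$, there is a group automorphism $\alpha$ of $G$ with $\alpha(S)=S'$. A Cayley graph $\mathrm{Cay}(G;S)$ is a CI graph if, for every symmetric subset $S'$ of $G$ such that $\mathrm{Cay}(G;S) \cong \mathrm{Cay}(G;S')$, there is a group automorphism $\alpha$ of $G$ with $\alpha(S)=S'$. $G$ is a DCI group if every Cayley digraph of $G$ is a DCI digraph, and $G$ is a CI group if every (undirected) Cayley graph of $G$ is a CI graph. -}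

module Defs where

open import Algebra.Bundles using (Group)
open import Algebra.Morphism.Structures using (module GroupMorphisms)
open import Data.Bool.Base using (Bool; T)
open import Data.Fin.Base using (Fin; zero; toℕ)
open import Data.Fin.Properties using (toℕ-injective; toℕ-fromℕ<; toℕ<n; toℕ≤n; *↔×)
open import Data.Nat.Base using (ℕ; zero; suc; _+_; _∸_; _^_; NonZero)
open import Data.Nat.DivMod
  using (_%_; _mod_; m%n<n; [m+n]%n≡m%n; m<n⇒m%n≡m; m%n%n≡m%n; %-distribˡ-+)
open import Data.Nat.Properties using (+-comm; +-assoc; m∸n+n≡m)
open import Data.Product.Base using (Σ; ∃-syntax; _×_; _,_)
open import Data.Product.Function.NonDependent.Propositional using (_×-↔_)
open import Data.Vec.Base using (Vec; []; _∷_; zipWith; replicate; map; uncons)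
open import Data.Vec.Properties
  using (zipWith-assoc; zipWith-identityˡ; zipWith-identityʳ; zipWith-inverseˡ; zipWith-inverseʳ)
open import Function.Bundles using (Func; Inverse; _⇔_; _↔_; mk↔ₛ′)
open import Function.Construct.Composition using (_↔-∘_)
open import Function.Construct.Identity using (↔-id)
open import Function.Construct.Symmetry using (↔-sym)
open import Level using (Level; 0ℓ; _⊔_) renaming (suc to lsuc)
open import Relation.Binary.Bundles using (Setoid)
open import Relation.Binary.Core using (Rel)
open import Relation.Binary.Definitions using (_Respects₂_)
open import Relation.Binary.PropositionalEquality
  using (_≡_; refl; sym; trans; cong; cong₂; setoid; isEquivalence; module ≡-Reasoning)

record FiniteGroup (c ℓ : Level) : Set (lsuc (c ⊔ ℓ)) where
  field
    group  : Group c ℓ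
  open Group group public renaming (setoid to setoidᴳ)
  field
    order  : ℕ
    finite : Inverse setoidᴳ (setoid (Fin order))

record Digraph (v ℓ e : Level) : Set (lsuc (v ⊔ ℓ ⊔ e)) where
  field
    vertices : Setoid v ℓ
  open Setoid vertices using (_≈_) renaming (Carrier to Vertex) public
  field
    _⟶_    : Rel Vertex e
    ⟶-resp : _⟶_ Respects₂ _≈_

infix 4 _≅_

_≅_ : ∀ {v ℓ e} → Digraph v ℓ e → Digraph v ℓ e → Set (v ⊔ ℓ ⊔ e)
Γ ≅ Δ = Σ (Inverse Γ.vertices Δ.vertices) λ φ →
          ∀ x y → (x Γ.⟶ y) ⇔ (Inverse.to φ x Δ.⟶ Inverse.to φ y)
  where
  module Γ = Digraph Γ
  module Δ = Digraph Δ

module _ {c ℓ : Level} (G : FiniteGroup c ℓ) where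
  open FiniteGroup G
  open GroupMorphisms rawGroup rawGroup using (IsGroupIsomorphism)

  -- Subsets of a finite group are given by characteristic functions, so
  -- membership is decidable; they respect the equality of the group.
  Subset : Set (c ⊔ ℓ)
  Subset = Func setoidᴳ (setoid Bool)

  _∈ˢ_ : Carrier → Subset → Set
  x ∈ˢ S = T (Func.to S x)

  Symmetric : Subset → Set c
  Symmetric S = ∀ x → (x ∈ˢ S) ⇔ ((x ⁻¹) ∈ˢ S)

  -- There is no separate type of undirected graphs: when S is symmetric the
  -- edge relation is symmetric, and this is the undirected Cayley graph.
  -- Subsets may contain the identity, so loops are allowed.
  Cay : Subset → Digraph c ℓ (c ⊔ ℓ)
  Cay S = record
    { vertices = setoidᴳ
    ; _⟶_      = λ g h → ∃[ s ] (s ∈ˢ S × h ≈ s ∙ g)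
    ; ⟶-resp   =
        (λ h≈h′ → λ (s , s∈S , h≈sg) → s , s∈S , Group.trans group (Group.sym group h≈h′) h≈sg) ,
        (λ g≈g′ → λ (s , s∈S , h≈sg) → s , s∈S , Group.trans group h≈sg (∙-congˡ g≈g′))
    }

  _[_]≐_ : (Carrier → Carrier) → Subset → Subset → Set (c ⊔ ℓ)
  α [ S ]≐ S′ = ∀ y → (y ∈ˢ S′) ⇔ (∃[ x ] (x ∈ˢ S × y ≈ α x))

  SameUnderAut : Subset → Subset → Set (c ⊔ ℓ)
  SameUnderAut S S′ = ∃[ α ] (IsGroupIsomorphism α × α [ S ]≐ S′)

  IsDCIDigraph : Subset → Set (c ⊔ ℓ)
  IsDCIDigraph S = ∀ S′ → Cay S ≅ Cay S′ → SameUnderAut S S′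

  IsCIGraph : Subset → Set (c ⊔ ℓ)
  IsCIGraph S = ∀ S′ → Symmetric S′ → Cay S ≅ Cay S′ → SameUnderAut S S′

  IsDCIGroup : Set (c ⊔ ℓ)
  IsDCIGroup = ∀ S → IsDCIDigraph S

  IsCIGroup : Set (c ⊔ ℓ)
  IsCIGroup = ∀ S → Symmetric S → IsCIGraph S

module ℤMod (n : ℕ) .{{_ : NonZero n}} where

  infixl 6 _⊕_

  _⊕_ : Fin n → Fin n → Fin n
  i ⊕ j = (toℕ i + toℕ j) mod n

  ⊖_ : Fin n → Fin n
  ⊖ i = (n ∸ toℕ i) mod n

  𝟘 : Fin n
  𝟘 = 0 mod n

  toℕ-mod : ∀ m → toℕ (m mod n) ≡ m % n
  toℕ-mod m = toℕ-fromℕ< (m%n<n m n)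

  toℕ-% : ∀ (i : Fin n) → toℕ i % n ≡ toℕ i
  toℕ-% i = m<n⇒m%n≡m (toℕ<n i)

  mod-toℕ : ∀ (i : Fin n) → toℕ i mod n ≡ i
  mod-toℕ i = toℕ-injective (trans (toℕ-mod (toℕ i)) (toℕ-% i))

  mod-cong : ∀ {a b} → a % n ≡ b % n → a mod n ≡ b mod n
  mod-cong {a} {b} eq = toℕ-injective (trans (toℕ-mod a) (trans eq (sym (toℕ-mod b))))

  %-+ˡ : ∀ a b → (a % n + b) % n ≡ (a + b) % n
  %-+ˡ a b = begin
    (a % n + b) % n         ≡⟨ %-distribˡ-+ (a % n) b n ⟩
    (a % n % n + b % n) % n ≡⟨ cong (λ z → (z + b % n) % n) (m%n%n≡m%n a n) ⟩
    (a % n + b % n) % n     ≡⟨ %-distribˡ-+ a b n ⟨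
    (a + b) % n             ∎
    where open ≡-Reasoning

  mod-⊕ : ∀ a j → (a mod n) ⊕ j ≡ (a + toℕ j) mod n
  mod-⊕ a j = mod-cong (trans (cong (λ z → (z + toℕ j) % n) (toℕ-mod a)) (%-+ˡ a (toℕ j)))

  ⊕-comm : ∀ i j → i ⊕ j ≡ j ⊕ i
  ⊕-comm i j = cong (_mod n) (+-comm (toℕ i) (toℕ j))

  ⊕-assoc : ∀ i j k → (i ⊕ j) ⊕ k ≡ i ⊕ (j ⊕ k)
  ⊕-assoc i j k = begin
    (i ⊕ j) ⊕ k                     ≡⟨ mod-⊕ (toℕ i + toℕ j) k ⟩
    (toℕ i + toℕ j + toℕ k) mod n   ≡⟨ cong (_mod n) (+-assoc (toℕ i) (toℕ j) (toℕ k)) ⟩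
    (toℕ i + (toℕ j + toℕ k)) mod n ≡⟨ cong (_mod n) (+-comm (toℕ i) (toℕ j + toℕ k)) ⟩
    (toℕ j + toℕ k + toℕ i) mod n   ≡⟨ mod-⊕ (toℕ j + toℕ k) i ⟨
    (j ⊕ k) ⊕ i                     ≡⟨ ⊕-comm (j ⊕ k) i ⟩
    i ⊕ (j ⊕ k)                     ∎
    where open ≡-Reasoning

  ⊕-identityˡ : ∀ i → 𝟘 ⊕ i ≡ i
  ⊕-identityˡ i = trans (mod-⊕ 0 i) (mod-toℕ i)

  ⊕-identityʳ : ∀ i → i ⊕ 𝟘 ≡ i
  ⊕-identityʳ i = trans (⊕-comm i 𝟘) (⊕-identityˡ i)

  ⊕-inverseˡ : ∀ i → (⊖ i) ⊕ i ≡ 𝟘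
  ⊕-inverseˡ i = begin
    (⊖ i) ⊕ i                   ≡⟨ mod-⊕ (n ∸ toℕ i) i ⟩
    (n ∸ toℕ i + toℕ i) mod n   ≡⟨ cong (_mod n) (m∸n+n≡m (toℕ≤n i)) ⟩
    n mod n                     ≡⟨ mod-cong ([m+n]%n≡m%n 0 n) ⟩
    𝟘                           ∎
    where open ≡-Reasoning

  ⊕-inverseʳ : ∀ i → i ⊕ (⊖ i) ≡ 𝟘
  ⊕-inverseʳ i = trans (⊕-comm i (⊖ i)) (⊕-inverseˡ i)

Vec↔Fin : ∀ n r → Vec (Fin n) r ↔ Fin (n ^ r)
Vec↔Fin n zero    = mk↔ₛ′ (λ _ → zero) (λ _ → []) (λ { zero → refl }) (λ { [] → refl })
Vec↔Fin n (suc r) =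
  (↔-sym *↔× ↔-∘ (↔-id (Fin n) ×-↔ Vec↔Fin n r)) ↔-∘
  mk↔ₛ′ uncons (λ (x , xs) → x ∷ xs) (λ _ → refl) (λ { (_ ∷ _) → refl })

ℤMod^ : (n : ℕ) .{{_ : NonZero n}} (r : ℕ) → FiniteGroup 0ℓ 0ℓ
ℤMod^ n r = record
  { group  = record
    { Carrier = Vec (Fin n) r
    ; _≈_     = _≡_
    ; _∙_     = zipWith _⊕_
    ; ε       = replicate r 𝟘
    ; _⁻¹     = map ⊖_
    ; isGroup = record
      { isMonoid = record
        { isSemigroup = record
          { isMagma = record
            { isEquivalence = isEquivalence
            ; ∙-cong        = cong₂ (zipWith _⊕_)
            }
          ; assoc = zipWith-assoc ⊕-assoc
          }
        ; identity = zipWith-identityˡ ⊕-identityˡ , zipWith-identityʳ ⊕-identityʳ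
        }
      ; inverse = zipWith-inverseˡ ⊕-inverseˡ , zipWith-inverseʳ ⊕-inverseʳ
      ; ⁻¹-cong = cong (map ⊖_)
      }
    }
  ; order  = n ^ r
  ; finite = Vec↔Fin n r
  }
  where open ℤMod n

{-# OPTIONS --safe #-}

-- Write H = W × G with W = (ℤ_p)³, G = (ℤ_p)^r, and S° = S ∖ {0}.  For p odd let e₁, e₂, e₃
-- be the standard basis of W, B = {± e₁, ± e₂, ± e₃}, and
--   K(S) = {eᵢ} × S°  ∪  {- eᵢ} × - S°  ∪  (W ∖ B) × {0},
-- which is symmetric.  If φ : Cay(G;S) ≅ Cay(G;S′), then id × φ : Cay(H;K(S)) ≅ Cay(H;K(S′)), so
-- the CI property of H yields α ∈ Aut H with α(K(S)) = K(S′).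
--
-- If x ∈ K(S) and x ± y ∈ K(S) for some y ∈ K(S) other than 0, x, - x, then x ∈ W × {0}.  The
-- vectors eᵢ + eⱼ have this property, so α and its inverse preserve W × {0}, and hence B × {0}.
-- For s ∈ S° write α(0 , s) = (w , s′); then w + α(eᵢ) ∈ B for i = 1, 2, 3, which forces w = 0.
-- Since α(e₁) is ± eⱼ, one of α, - α maps {0} × S° onto {0} × S′°.
--
-- Finally, an automorphism of H that maps {0} × S° onto {0} × S′° agrees on S° with one of G, because
-- an automorphism of (ℤ_p)^(n+1) can be corrected to one that preserves the hyperplane (ℤ_p)^n
-- without changing it where it already maps the hyperplane into itself.
-- For p = 2 every subset is symmetric, and K(S) = {0} × S° suffices.

module Submission where

open import Defs
open import Data.Nat.Base using (ℕ; _+_)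
open import Data.Nat.Primality using (Prime; prime⇒nonZero)
open import Relation.Nullary.Negation using (¬_)

open import Algebra.Bundles using (AbelianGroup)
open import Algebra.Morphism.Structures using (module GroupMorphisms)
import Algebra.Properties.AbelianGroup as AbelianGroupProperties
import Algebra.Properties.CommutativeMonoid.Mult as Mult
import Algebra.Properties.CommutativeSemigroup as CommutativeSemigroupProperties
open import Data.Bool.Base using (Bool; T)
open import Data.Fin.Base using (Fin; zero; suc; toℕ; opposite; _↑ˡ_)
open import Data.Fin.Properties using (toℕ<n; all?; ↑ˡ-injective; opposite-involutive)
  renaming (_≟_ to _≟ᶠ_; any? to anyᶠ?)
open import Data.Integer.Base as ℤ using (ℤ; +_; -[1+_]; ∣_∣)
  renaming (_⊖_ to _⊖ℤ_; -_ to negateℤ)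
import Data.Integer.Properties as ℤ
open import Data.Nat.Base using (zero; suc; _*_; _<_; NonZero; ≢-nonZero; nonTrivial⇒n>1; z<s)
open import Data.Nat.Coprimality using (prime⇒coprime; coprime-Bézout)
open import Data.Nat.Divisibility using (_∣_; _∣?_; ∣⇒≤; ∣-trans; m%n≡0⇒n∣m)
open import Data.Nat.DivMod
  using (_%_; _/_; _mod_; m≡m%n+[m/n]*n; [m+kn]%n≡m%n; m<n⇒m%n≡m; m*n%n≡0)
open import Data.Nat.GCD using (module Bézout)
open import Data.Nat.Primality using (prime⇒nonTrivial; euclidsLemma)
import Data.Nat.Properties as ℕ
open import Data.Product.Base using (Σ; ∃-syntax; _×_; _,_; proj₁; proj₂)
open import Data.Sum.Base using (_⊎_; inj₁; inj₂; [_,_]′)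
open import Data.Unit.Base using (tt)
open import Data.Vec.Base using (Vec; []; _∷_; _++_; head; tail; take; drop; lookup; map; zipWith)
open import Data.Vec.Properties using (zipWith-comm; zipWith-++; map-++; ≡-dec)
open import Data.Vec.Relation.Unary.Any using (Any; here; there; any?)
open import Function.Base using (_∘_; id)
open import Function.Bundles using (Func; Inverse; Equivalence; _⇔_; _↔_; mk⇔; mk↔ₛ′)
open import Level using (0ℓ)
open import Relation.Binary.PropositionalEquality
  using (_≡_; _≢_; refl; sym; trans; cong; cong₂; subst; subst₂; isEquivalence; module ≡-Reasoning)
open import Relation.Nullary.Decidable
  using (Dec; yes; no; ⌊_⌋; T?; _×-dec_; _⊎-dec_; ¬?; toWitness; fromWitness)
open import Relation.Nullary.Negation using (contradiction)

-- Additive maps between abelian groups.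

module AdditiveMap (A B : AbelianGroup 0ℓ 0ℓ) where
  private
    module A = AbelianGroup A
    module B = AbelianGroup B
    module A• = Mult A.commutativeMonoid
    module B• = Mult B.commutativeMonoid
  open AbelianGroupProperties B
  open GroupMorphisms A.rawGroup B.rawGroup using (IsGroupHomomorphism)

  module _ {f : A.Carrier → B.Carrier}
           (f-cong : ∀ {x y} → x A.≈ y → f x B.≈ f y)
           (f-∙ : ∀ x y → f (x A.∙ y) B.≈ f x B.∙ f y) where

    ε-homo : f A.ε B.≈ B.ε
    ε-homo = identityˡ-unique (f A.ε) (f A.ε)
      (B.trans (B.sym (f-∙ A.ε A.ε)) (f-cong (A.identityˡ A.ε)))

    ⁻¹-homo : ∀ x → f (x A.⁻¹) B.≈ f x B.⁻¹
    ⁻¹-homo x = inverseˡ-unique _ _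
      (B.trans (B.sym (f-∙ (x A.⁻¹) x)) (B.trans (f-cong (A.inverseˡ x)) ε-homo))

    isGroupHomomorphism : IsGroupHomomorphism f
    isGroupHomomorphism = record
      { isMonoidHomomorphism = record
        { isMagmaHomomorphism = record
          { isRelHomomorphism = record { cong = f-cong } ; homo = f-∙ }
        ; ε-homo = ε-homo }
      ; ⁻¹-homo = ⁻¹-homo }

    ×-homo : ∀ n x → f (n A•.× x) B.≈ n B•.× f x
    ×-homo zero    x = ε-homo
    ×-homo (suc n) x = B.trans (f-∙ x (n A•.× x)) (B.∙-congˡ (×-homo n x))

-- Scalars and vectors modulo `p`.

module ElementaryAbelian (p : ℕ) (pp : Prime p) where

  private instance
    p≢0 : NonZero p
    p≢0 = prime⇒nonZero pp

  open ℤMod p public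

  𝔽 : AbelianGroup 0ℓ 0ℓ
  𝔽 = record
    { Carrier = Fin p ; _≈_ = _≡_ ; _∙_ = _⊕_ ; ε = 𝟘 ; _⁻¹ = ⊖_
    ; isAbelianGroup = record
      { isGroup = record
        { isMonoid = record
          { isSemigroup = record
            { isMagma = record
              { isEquivalence = isEquivalence
              ; ∙-cong = cong₂ _⊕_ }
            ; assoc = ⊕-assoc }
          ; identity = ⊕-identityˡ , ⊕-identityʳ }
        ; inverse = ⊕-inverseˡ , ⊕-inverseʳ
        ; ⁻¹-cong = cong ⊖_ }
      ; comm = ⊕-comm } }

  V : ℕ → Set
  V n = Vec (Fin p) n

  𝕍 : ℕ → AbelianGroup 0ℓ 0ℓ
  𝕍 n = record
    { isAbelianGroup = record
      { isGroup = FiniteGroup.isGroup (ℤMod^ p n) ; comm = zipWith-comm ⊕-comm } }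

  open module Vᵍ {n} = AbelianGroup (𝕍 n) using (identityˡ; identityʳ; inverseˡ; inverseʳ)
    renaming (_∙_ to infixl 6 _✚_; ε to 𝟎; _⁻¹ to infix 8 ⊝_; _-_ to infixl 6 _─_)
  open module Vᵖ {n} = AbelianGroupProperties (𝕍 n)
    using (x∙y⁻¹≈ε⇒x≈y; ⁻¹-involutive; ⁻¹-∙-comm; ε⁻¹≈ε; x≈y⇒x∙y⁻¹≈ε)
  open module V• {n} = Mult (AbelianGroup.commutativeMonoid (𝕍 n))
    using (×-homo-+; ×-assocˡ; ×-distrib-+) renaming (_×_ to infixr 7 _•_)
  module F• = Mult (AbelianGroup.commutativeMonoid 𝔽)
  open F• using () renaming (_×_ to infixr 7 _•ᶠ_)

  infixr 7 _·_
  _·_ : ∀ {n} → Fin p → V n → V n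
  c · x = toℕ c • x

  𝟙 : Fin p
  𝟙 = 1 mod p

  1<p : 1 < p
  1<p = nonTrivial⇒n>1 p {{prime⇒nonTrivial pp}}

  toℕ𝟘 : toℕ 𝟘 ≡ 0
  toℕ𝟘 = trans (toℕ-mod 0) (m<n⇒m%n≡m (ℕ.<-trans z<s 1<p))

  toℕ𝟙 : toℕ 𝟙 ≡ 1
  toℕ𝟙 = trans (toℕ-mod 1) (m<n⇒m%n≡m 1<p)

  •𝟙 : ∀ n → n •ᶠ 𝟙 ≡ n mod p
  •𝟙 zero    = refl
  •𝟙 (suc n) = begin
    𝟙 ⊕ (n •ᶠ 𝟙)          ≡⟨ cong (𝟙 ⊕_) (•𝟙 n) ⟩
    𝟙 ⊕ (n mod p)         ≡⟨ ⊕-comm 𝟙 (n mod p) ⟩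
    (n mod p) ⊕ 𝟙         ≡⟨ mod-⊕ n 𝟙 ⟩
    (n + toℕ 𝟙) mod p     ≡⟨ cong (λ k → (n + k) mod p) toℕ𝟙 ⟩
    (n + 1) mod p         ≡⟨ cong (_mod p) (ℕ.+-comm n 1) ⟩
    suc n mod p           ∎
    where open ≡-Reasoning

  toℕ•𝟙 : ∀ i → toℕ i •ᶠ 𝟙 ≡ i
  toℕ•𝟙 i = trans (•𝟙 (toℕ i)) (mod-toℕ i)

  -- Repeated addition stands in for multiplication in the field: writing `i` as a multiple of `𝟙`
  -- turns it into a product of natural numbers, which gives commutativity in `•ᶠ-comm`.
  •ᶠ-mod : ∀ n i → n •ᶠ i ≡ (n * toℕ i) mod p
  •ᶠ-mod n i = begin
    n •ᶠ i              ≡⟨ cong (n •ᶠ_) (toℕ•𝟙 i) ⟨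
    n •ᶠ toℕ i •ᶠ 𝟙     ≡⟨ F•.×-assocˡ 𝟙 n (toℕ i) ⟩
    (n * toℕ i) •ᶠ 𝟙    ≡⟨ •𝟙 (n * toℕ i) ⟩
    (n * toℕ i) mod p   ∎
    where open ≡-Reasoning

  •ᶠ-comm : ∀ i j → toℕ i •ᶠ j ≡ toℕ j •ᶠ i
  •ᶠ-comm i j = trans (•ᶠ-mod (toℕ i) j)
    (trans (cong (_mod p) (ℕ.*-comm (toℕ i) (toℕ j))) (sym (•ᶠ-mod (toℕ j) i)))

  •-•ᶠ-comm : ∀ m n i → m •ᶠ n •ᶠ i ≡ n •ᶠ m •ᶠ i
  •-•ᶠ-comm m n i = trans (F•.×-assocˡ i m n) (trans (F•.×-congˡ (ℕ.*-comm m n)) (sym (F•.×-assocˡ i n m)))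

  •ᶠ-𝟘 : ∀ n → n •ᶠ 𝟘 ≡ 𝟘
  •ᶠ-𝟘 zero    = refl
  •ᶠ-𝟘 (suc n) = trans (⊕-identityˡ (n •ᶠ 𝟘)) (•ᶠ-𝟘 n)

  p•ᶠ≡𝟘 : ∀ i → p •ᶠ i ≡ 𝟘
  p•ᶠ≡𝟘 i = trans (•ᶠ-mod p i)
    (mod-cong (trans (cong (_% p) (ℕ.*-comm p (toℕ i))) (trans (m*n%n≡0 (toℕ i) p) (sym (m<n⇒m%n≡m (ℕ.<-trans z<s 1<p))))))

  𝟙≢𝟘 : 𝟙 ≢ 𝟘
  𝟙≢𝟘 eq with () ← trans (sym toℕ𝟙)
    (trans (cong toℕ eq) toℕ𝟘)

  •-∷ : ∀ {n} k a (x : V n) → k • (a ∷ x) ≡ (k •ᶠ a) ∷ (k • x)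
  •-∷ zero    a x = refl
  •-∷ (suc k) a x = cong ((a ∷ x) ✚_) (•-∷ k a x)

  p•≡𝟎 : ∀ {n} (x : V n) → p • x ≡ 𝟎
  p•≡𝟎 []      with [] ← p • [] = refl
  p•≡𝟎 (a ∷ x) = trans (•-∷ p a x) (cong₂ _∷_ (p•ᶠ≡𝟘 a) (p•≡𝟎 x))

  •-𝟎 : ∀ {n} k → k • 𝟎 {n} ≡ 𝟎
  •-𝟎 zero    = refl
  •-𝟎 (suc k) = trans (identityˡ _) (•-𝟎 k)

  -- Every vector is killed by `p`, so only the residue of the multiplier counts; this makes `_·_`
  -- distribute over the modular sum of scalars.
  •-% : ∀ {n} k (x : V n) → (k % p) • x ≡ k • x
  •-% k x = sym (begin
    k • x                                  ≡⟨ cong (_• x) (m≡m%n+[m/n]*n k p) ⟩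
    (k % p + k / p * p) • x                ≡⟨ ×-homo-+ x (k % p) (k / p * p) ⟩
    (k % p) • x ✚ (k / p * p) • x          ≡⟨ cong ((k % p) • x ✚_) (×-assocˡ x (k / p) p) ⟨
    (k % p) • x ✚ (k / p) • p • x          ≡⟨ cong (λ y → (k % p) • x ✚ (k / p) • y) (p•≡𝟎 x) ⟩
    (k % p) • x ✚ (k / p) • 𝟎              ≡⟨ cong ((k % p) • x ✚_) (•-𝟎 (k / p)) ⟩
    (k % p) • x ✚ 𝟎                        ≡⟨ identityʳ _ ⟩
    (k % p) • x                            ∎)
    where open ≡-Reasoning

  ·-distribʳ : ∀ {n} a b (x : V n) → (a ⊕ b) · x ≡ a · x ✚ b · x
  ·-distribʳ a b x = trans (cong (_• x) (toℕ-mod (toℕ a + toℕ b)))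
    (trans (•-% (toℕ a + toℕ b) x) (×-homo-+ x (toℕ a) (toℕ b)))

  𝟘· : ∀ {n} (x : V n) → 𝟘 · x ≡ 𝟎
  𝟘· x = cong (_• x) toℕ𝟘

  inverse : ∀ {a} → a ≢ 𝟘 → ∃[ m ] (m •ᶠ a ≡ 𝟙)
  inverse {a} a≢𝟘 = go (coprime-Bézout (prime⇒coprime pp {{a≢0}} (toℕ<n a)))
    where
    open Bézout
    a≢0 : NonZero (toℕ a)
    a≢0 = ≢-nonZero λ eq → a≢𝟘 (trans (sym (mod-toℕ a)) (cong (_mod p) eq))
    go : Identity 1 p (toℕ a) → ∃[ m ] (m •ᶠ a ≡ 𝟙)
    go (-+ x y eq) = y , trans (•ᶠ-mod y a) (mod-cong (trans (cong (_% p) (sym eq)) ([m+kn]%n≡m%n 1 x p)))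
    -- In this Bézout case `1 + y * toℕ a` is a multiple of `p`, so `y` inverts `a` only up to sign
    -- and its negative is taken.
    go (+- x y eq) = toℕ (⊖ (y mod p)) , (begin
      toℕ (⊖ (y mod p)) •ᶠ a    ≡⟨ •ᶠ-comm (⊖ (y mod p)) a ⟩
      toℕ a •ᶠ ⊖ (y mod p)      ≡⟨ AdditiveMap.⁻¹-homo 𝔽 𝔽 (cong (toℕ a •ᶠ_)) (λ u v → F•.×-distrib-+ u v (toℕ a)) (y mod p) ⟩
      ⊖ (toℕ a •ᶠ (y mod p))    ≡⟨ AbelianGroupProperties.inverseˡ-unique 𝔽 _ _ 1+ya≡0 ⟨
      𝟙                         ∎)
      where
      open ≡-Reasoning
      1+ya≡0 : 𝟙 ⊕ (toℕ a •ᶠ (y mod p)) ≡ 𝟘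
      1+ya≡0 = begin
        𝟙 ⊕ (toℕ a •ᶠ (y mod p))       ≡⟨ cong (λ u → 𝟙 ⊕ (toℕ a •ᶠ u)) (•𝟙 y) ⟨
        𝟙 ⊕ (toℕ a •ᶠ y •ᶠ 𝟙)          ≡⟨ cong (𝟙 ⊕_) (F•.×-assocˡ 𝟙 (toℕ a) y) ⟩
        (suc (toℕ a * y)) •ᶠ 𝟙         ≡⟨ cong (λ k → suc k •ᶠ 𝟙) (ℕ.*-comm (toℕ a) y) ⟩
        (1 + y * toℕ a) •ᶠ 𝟙           ≡⟨ cong (_•ᶠ 𝟙) eq ⟩
        (x * p) •ᶠ 𝟙                   ≡⟨ cong (_•ᶠ 𝟙) (ℕ.*-comm x p) ⟩
        (p * x) •ᶠ 𝟙                   ≡⟨ F•.×-assocˡ 𝟙 p x ⟨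
        p •ᶠ x •ᶠ 𝟙                    ≡⟨ p•ᶠ≡𝟘 _ ⟩
        𝟘                              ∎

  𝟙· : ∀ {n} (x : V n) → 𝟙 · x ≡ x
  𝟙· x = trans (cong (_• x) toℕ𝟙) (V•.×-homo-1 x)

  -- Projections along a vector.

  module Projection {n : ℕ} (d : V n) (F : V n → Fin p)
                    (F-✚ : ∀ x y → F (x ✚ y) ≡ F x ⊕ F y) (Fd≡𝟙 : F d ≡ 𝟙) where

    -- The linear projection onto the kernel of `F` along `d`.
    proj : V n → V n
    proj x = x ─ F x · d

    proj-✚ : ∀ x y → proj (x ✚ y) ≡ proj x ✚ proj y
    proj-✚ x y = begin
      (x ✚ y) ─ F (x ✚ y) · d                ≡⟨ cong (λ c → (x ✚ y) ─ c · d) (F-✚ x y) ⟩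
      (x ✚ y) ─ (F x ⊕ F y) · d              ≡⟨ cong ((x ✚ y) ─_) (·-distribʳ (F x) (F y) d) ⟩
      (x ✚ y) ─ (F x · d ✚ F y · d)          ≡⟨ cong ((x ✚ y) ✚_) (⁻¹-∙-comm (F x · d) (F y · d)) ⟨
      (x ✚ y) ✚ (⊝ (F x · d) ✚ ⊝ (F y · d))  ≡⟨ interchange x y (⊝ (F x · d)) (⊝ (F y · d)) ⟩
      proj x ✚ proj y                        ∎
      where
      open ≡-Reasoning
      open CommutativeSemigroupProperties (AbelianGroup.commutativeSemigroup (𝕍 n)) using (interchange)

    proj-fix : ∀ {x} → F x ≡ 𝟘 → proj x ≡ x
    proj-fix {x} Fx≡𝟘 = begin
      x ─ F x · d   ≡⟨ cong (λ c → x ─ c · d) Fx≡𝟘 ⟩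
      x ─ 𝟘 · d     ≡⟨ cong (x ─_) (𝟘· d) ⟩
      x ─ 𝟎         ≡⟨ cong (x ✚_) ε⁻¹≈ε ⟩
      x ✚ 𝟎         ≡⟨ identityʳ x ⟩
      x             ∎
      where open ≡-Reasoning

    F-proj : ∀ x → F (proj x) ≡ 𝟘
    F-proj x = begin
      F (x ─ F x · d)              ≡⟨ F-✚ x (⊝ (F x · d)) ⟩
      F x ⊕ F (⊝ (F x · d))        ≡⟨ cong (F x ⊕_) (⁻¹-homo (cong F) F-✚ (F x · d)) ⟩
      F x ⊕ (⊖ F (F x · d))        ≡⟨ cong (λ c → F x ⊕ (⊖ c)) (×-homo (cong F) F-✚ (toℕ (F x)) d) ⟩
      F x ⊕ (⊖ (toℕ (F x) •ᶠ F d)) ≡⟨ cong (λ c → F x ⊕ (⊖ (toℕ (F x) •ᶠ c))) Fd≡𝟙 ⟩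
      F x ⊕ (⊖ (toℕ (F x) •ᶠ 𝟙))   ≡⟨ cong (λ c → F x ⊕ (⊖ c)) (toℕ•𝟙 (F x)) ⟩
      F x ⊕ (⊖ F x)                ≡⟨ ⊕-inverseʳ (F x) ⟩
      𝟘                            ∎
      where
      open ≡-Reasoning
      open AdditiveMap (𝕍 n) 𝔽

    -- The vector `d` itself projects to zero. Hence the projections along `d` onto the kernels of
    -- two functionals are mutually inverse between these kernels.
    proj-along : ∀ x c → proj (x ─ c · d) ≡ proj x
    proj-along x c = begin
      proj (x ─ c · d)             ≡⟨ proj-✚ x (⊝ (c · d)) ⟩
      proj x ✚ proj (⊝ (c · d))    ≡⟨ cong (proj x ✚_) (⁻¹-homo (cong proj) proj-✚ (c · d)) ⟩
      proj x ─ proj (c · d)        ≡⟨ cong (proj x ─_) (×-homo (cong proj) proj-✚ (toℕ c) d) ⟩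
      proj x ─ c · proj d          ≡⟨ cong (λ y → proj x ─ c · y) proj-d ⟩
      proj x ─ c · 𝟎               ≡⟨ cong (proj x ─_) (•-𝟎 (toℕ c)) ⟩
      proj x ─ 𝟎                   ≡⟨ cong (proj x ✚_) ε⁻¹≈ε ⟩
      proj x ✚ 𝟎                   ≡⟨ identityʳ (proj x) ⟩
      proj x                       ∎
      where
      open ≡-Reasoning
      open AdditiveMap (𝕍 n) (𝕍 n)
      proj-d : proj d ≡ 𝟎
      proj-d = x≈y⇒x∙y⁻¹≈ε (sym (trans (cong (_· d) Fd≡𝟙) (𝟙· d)))

  -- Automorphisms with explicit inverses.

  record Automorphism (n : ℕ) : Set where
    field
      to from : V n → V n
      to-✚    : ∀ x y → to (x ✚ y) ≡ to x ✚ to y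
      to∘from : ∀ y → to (from y) ≡ y
      from∘to : ∀ x → from (to x) ≡ x

    to-injective : ∀ {x y} → to x ≡ to y → x ≡ y
    to-injective {x} {y} eq = trans (sym (from∘to x)) (trans (cong from eq) (from∘to y))

    from-✚ : ∀ x y → from (x ✚ y) ≡ from x ✚ from y
    from-✚ x y = to-injective (begin
      to (from (x ✚ y))          ≡⟨ to∘from (x ✚ y) ⟩
      x ✚ y                      ≡⟨ cong₂ _✚_ (to∘from x) (to∘from y) ⟨
      to (from x) ✚ to (from y)  ≡⟨ to-✚ (from x) (from y) ⟨
      to (from x ✚ from y)       ∎)
      where open ≡-Reasoning

    open AdditiveMap (𝕍 n) (𝕍 n)

    to-𝟎 : to 𝟎 ≡ 𝟎
    to-𝟎 = ε-homo (cong to) to-✚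

    to-⊝ : ∀ x → to (⊝ x) ≡ ⊝ to x
    to-⊝ = ⁻¹-homo (cong to) to-✚

    open GroupMorphisms (AbelianGroup.rawGroup (𝕍 n)) (AbelianGroup.rawGroup (𝕍 n))

    isGroupIsomorphism : IsGroupIsomorphism to
    isGroupIsomorphism = record
      { isGroupMonomorphism = record
        { isGroupHomomorphism = isGroupHomomorphism (cong to) to-✚ ; injective = to-injective }
      ; surjective = λ y → from y , λ { refl → to∘from y } }

  open Automorphism

  inv : ∀ {n} → Automorphism n → Automorphism n
  inv α = record { to = from α ; from = to α ; to-✚ = from-✚ α ; to∘from = from∘to α ; from∘to = to∘from α }

  neg : ∀ {n} → Automorphism n → Automorphism n
  neg α = record
    { to = λ x → ⊝ to α x
    ; from = λ y → from α (⊝ y)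
    ; to-✚ = λ x y → trans (cong ⊝_ (to-✚ α x y)) (sym (⁻¹-∙-comm (to α x) (to α y)))
    ; to∘from = λ y → trans (cong ⊝_ (to∘from α (⊝ y))) (⁻¹-involutive y)
    ; from∘to = λ x → trans (cong (from α) (⁻¹-involutive (to α x))) (from∘to α x) }

  -- Correcting an automorphism to preserve a hyperplane.

  head-✚ : ∀ {n} (x y : V (suc n)) → head (x ✚ y) ≡ head x ⊕ head y
  head-✚ (_ ∷ _) (_ ∷ _) = refl

  tail-✚ : ∀ {n} (x y : V (suc n)) → tail (x ✚ y) ≡ tail x ✚ tail y
  tail-✚ (_ ∷ _) (_ ∷ _) = refl

  head-𝟘 : ∀ {n} {x : V (suc n)} → head x ≡ 𝟘 → 𝟘 ∷ tail x ≡ x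
  head-𝟘 {x = _ ∷ _} refl = refl

  module _ {n : ℕ} (α : Automorphism (suc n)) where
    private
      f : V (suc n) → Fin p
      f = head ∘ to α

      f-✚ : ∀ x y → f (x ✚ y) ≡ f x ⊕ f y
      f-✚ x y = trans (cong head (to-✚ α x y)) (head-✚ (to α x) (to α y))

    -- Two proper hyperplanes do not cover the space. If `f` vanishes at `e`, the preimage `a` of
    -- `e` still has `f a ≡ 𝟙`; projecting it along `e` keeps this value and makes its head zero, so
    -- adding the result to `e` works.
    transversal : ∃[ d ] (head d ≡ 𝟙 × f d ≢ 𝟘)
    transversal with f (𝟙 ∷ 𝟎) ≟ᶠ 𝟘
    ... | no fe≢𝟘 = 𝟙 ∷ 𝟎 , refl , fe≢𝟘
    ... | yes fe≡𝟘 = e ✚ g , head-d , λ fd≡𝟘 → 𝟙≢𝟘 (trans (sym f-d) fd≡𝟘)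
      where
      open ≡-Reasoning
      open AdditiveMap (𝕍 (suc n)) 𝔽
      e a g : V (suc n)
      e = 𝟙 ∷ 𝟎
      a = from α e
      g = proj a
        where open Projection e head head-✚ refl
      head-d : head (e ✚ g) ≡ 𝟙
      head-d = trans (head-✚ e g) (trans (cong (𝟙 ⊕_) (Projection.F-proj e head head-✚ refl a)) (⊕-identityʳ 𝟙))
      f-d : f (e ✚ g) ≡ 𝟙
      f-d = begin
        f (e ✚ g)                          ≡⟨ f-✚ e g ⟩
        f e ⊕ f (a ─ head a · e)           ≡⟨ cong (_⊕ f g) fe≡𝟘 ⟩
        𝟘 ⊕ f (a ─ head a · e)             ≡⟨ ⊕-identityˡ (f g) ⟩
        f (a ─ head a · e)                 ≡⟨ f-✚ a (⊝ (head a · e)) ⟩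
        f a ⊕ f (⊝ (head a · e))           ≡⟨ cong₂ _⊕_ (cong head (to∘from α e)) (⁻¹-homo (cong f) f-✚ (head a · e)) ⟩
        𝟙 ⊕ (⊖ f (head a · e))             ≡⟨ cong (λ c → 𝟙 ⊕ (⊖ c)) (×-homo (cong f) f-✚ (toℕ (head a)) e) ⟩
        𝟙 ⊕ (⊖ (toℕ (head a) •ᶠ f e))      ≡⟨ cong (λ c → 𝟙 ⊕ (⊖ (toℕ (head a) •ᶠ c))) fe≡𝟘 ⟩
        𝟙 ⊕ (⊖ (toℕ (head a) •ᶠ 𝟘))        ≡⟨ cong (λ c → 𝟙 ⊕ (⊖ c)) (•ᶠ-𝟘 (toℕ (head a))) ⟩
        𝟙 ⊕ (⊖ 𝟘)                          ≡⟨ cong (𝟙 ⊕_) (AbelianGroupProperties.ε⁻¹≈ε 𝔽) ⟩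
        𝟙 ⊕ 𝟘                              ≡⟨ ⊕-identityʳ 𝟙 ⟩
        𝟙                                  ∎

    -- With d transversal, the hyperplanes head = 0 and head ∘ α = 0 are identified by
    -- projecting along d; vectors common to both are fixed.
    restrict : Σ (Automorphism n) λ β → ∀ x y → to α (𝟘 ∷ x) ≡ 𝟘 ∷ y → to β x ≡ y
    restrict = β , λ x y eq → cong tail (trans (cong (to α) (F.proj-fix (fixed eq))) eq)
      where
      d = proj₁ transversal
      f-d≢𝟘 = proj₂ (proj₂ transversal)
      -- Multiplying `f` by the inverse of `f d` normalizes its value at `d` to `𝟙`, as `Projection`
      -- requires, and keeps its kernel.
      m = proj₁ (inverse f-d≢𝟘)

      F : V (suc n) → Fin p
      F x = m •ᶠ f x

      F-✚ : ∀ x y → F (x ✚ y) ≡ F x ⊕ F y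
      F-✚ x y = trans (cong (m •ᶠ_) (f-✚ x y)) (F•.×-distrib-+ (f x) (f y) m)

      module F = Projection d F F-✚ (proj₂ (inverse f-d≢𝟘))
      module H = Projection d head head-✚ (proj₁ (proj₂ transversal))

      fixed : ∀ {x y} → to α x ≡ 𝟘 ∷ y → F x ≡ 𝟘
      fixed eq = trans (cong ((m •ᶠ_) ∘ head) eq) (•ᶠ-𝟘 m)

      F≡𝟘⇒f≡𝟘 : ∀ {x} → F x ≡ 𝟘 → f x ≡ 𝟘
      F≡𝟘⇒f≡𝟘 {x} Fx≡𝟘 = begin
        f x                            ≡⟨ toℕ•𝟙 (f x) ⟨
        toℕ (f x) •ᶠ 𝟙                 ≡⟨ cong (toℕ (f x) •ᶠ_) (proj₂ (inverse f-d≢𝟘)) ⟨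
        toℕ (f x) •ᶠ m •ᶠ f d          ≡⟨ •-•ᶠ-comm (toℕ (f x)) m (f d) ⟩
        m •ᶠ toℕ (f x) •ᶠ f d          ≡⟨ cong (m •ᶠ_) (•ᶠ-comm (f x) (f d)) ⟩
        m •ᶠ toℕ (f d) •ᶠ f x          ≡⟨ •-•ᶠ-comm m (toℕ (f d)) (f x) ⟩
        toℕ (f d) •ᶠ F x               ≡⟨ cong (toℕ (f d) •ᶠ_) Fx≡𝟘 ⟩
        toℕ (f d) •ᶠ 𝟘                 ≡⟨ •ᶠ-𝟘 (toℕ (f d)) ⟩
        𝟘                              ∎
        where open ≡-Reasoning

      down up : V n → V n
      down x = tail (to α (F.proj (𝟘 ∷ x)))
      up y = tail (H.proj (from α (𝟘 ∷ y)))

      0∷down : ∀ x → 𝟘 ∷ down x ≡ to α (F.proj (𝟘 ∷ x))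
      0∷down x = head-𝟘 (F≡𝟘⇒f≡𝟘 (F.F-proj (𝟘 ∷ x)))

      0∷up : ∀ y → 𝟘 ∷ up y ≡ H.proj (from α (𝟘 ∷ y))
      0∷up y = head-𝟘 (H.F-proj (from α (𝟘 ∷ y)))

      β : Automorphism n
      β = record
        { to = down
        ; from = up
        ; to-✚ = λ x y → begin
            tail (to α (F.proj (𝟘 ∷ (x ✚ y))))
              ≡⟨ cong (λ c → tail (to α (F.proj (c ∷ (x ✚ y))))) (⊕-identityˡ 𝟘) ⟨
            tail (to α (F.proj ((𝟘 ∷ x) ✚ (𝟘 ∷ y))))
              ≡⟨ cong (tail ∘ to α) (F.proj-✚ (𝟘 ∷ x) (𝟘 ∷ y)) ⟩
            tail (to α (F.proj (𝟘 ∷ x) ✚ F.proj (𝟘 ∷ y)))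
              ≡⟨ cong tail (to-✚ α (F.proj (𝟘 ∷ x)) (F.proj (𝟘 ∷ y))) ⟩
            tail (to α (F.proj (𝟘 ∷ x)) ✚ to α (F.proj (𝟘 ∷ y)))
              ≡⟨ tail-✚ (to α (F.proj (𝟘 ∷ x))) (to α (F.proj (𝟘 ∷ y))) ⟩
            down x ✚ down y ∎
        ; to∘from = λ y → cong tail (begin
            to α (F.proj (𝟘 ∷ up y))                   ≡⟨ cong (to α ∘ F.proj) (0∷up y) ⟩
            to α (F.proj (H.proj (from α (𝟘 ∷ y))))    ≡⟨ cong (to α) (F.proj-along (from α (𝟘 ∷ y)) (head (from α (𝟘 ∷ y)))) ⟩
            to α (F.proj (from α (𝟘 ∷ y)))             ≡⟨ cong (to α) (F.proj-fix (fixed (to∘from α (𝟘 ∷ y)))) ⟩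
            to α (from α (𝟘 ∷ y))                      ≡⟨ to∘from α (𝟘 ∷ y) ⟩
            𝟘 ∷ y                                      ∎)
        ; from∘to = λ x → cong tail (begin
            H.proj (from α (𝟘 ∷ down x))               ≡⟨ cong (H.proj ∘ from α) (0∷down x) ⟩
            H.proj (from α (to α (F.proj (𝟘 ∷ x))))    ≡⟨ cong H.proj (from∘to α (F.proj (𝟘 ∷ x))) ⟩
            H.proj (F.proj (𝟘 ∷ x))                    ≡⟨ H.proj-along (𝟘 ∷ x) (F (𝟘 ∷ x)) ⟩
            H.proj (𝟘 ∷ x)                             ≡⟨ H.proj-fix refl ⟩
            𝟘 ∷ x                                      ∎) }
        where open ≡-Reasoning

  -- The decomposition `W × G` of the larger group.

  W : ∀ {n} → V (3 + n) → V 3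
  W = take 3

  G : ∀ {n} → V (3 + n) → V n
  G = drop 3

  W-++ : ∀ {n} (w : V 3) (g : V n) → W (w ++ g) ≡ w
  W-++ (_ ∷ _ ∷ _ ∷ []) g = refl

  G-++ : ∀ {n} (w : V 3) (g : V n) → G (w ++ g) ≡ g
  G-++ (_ ∷ _ ∷ _ ∷ []) g = refl

  W-✚ : ∀ {n} (x y : V (3 + n)) → W (x ✚ y) ≡ W x ✚ W y
  W-✚ (_ ∷ _ ∷ _ ∷ _) (_ ∷ _ ∷ _ ∷ _) = refl

  G-✚ : ∀ {n} (x y : V (3 + n)) → G (x ✚ y) ≡ G x ✚ G y
  G-✚ (_ ∷ _ ∷ _ ∷ _) (_ ∷ _ ∷ _ ∷ _) = refl

  W-⊝ : ∀ {n} (x : V (3 + n)) → W (⊝ x) ≡ ⊝ W x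
  W-⊝ (_ ∷ _ ∷ _ ∷ _) = refl

  G-⊝ : ∀ {n} (x : V (3 + n)) → G (⊝ x) ≡ ⊝ G x
  G-⊝ (_ ∷ _ ∷ _ ∷ _) = refl

  W-─ : ∀ {n} (x y : V (3 + n)) → W (x ─ y) ≡ W x ─ W y
  W-─ x y = trans (W-✚ x (⊝ y)) (cong (W x ✚_) (W-⊝ y))

  G-─ : ∀ {n} (x y : V (3 + n)) → G (x ─ y) ≡ G x ─ G y
  G-─ x y = trans (G-✚ x (⊝ y)) (cong (G x ✚_) (G-⊝ y))

  WG-ext : ∀ {n} {x y : V (3 + n)} → W x ≡ W y → G x ≡ G y → x ≡ y
  WG-ext {x = _ ∷ _ ∷ _ ∷ _} {_ ∷ _ ∷ _ ∷ _} refl refl = refl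

  ++-✚ : ∀ {n} (w w′ : V 3) (g g′ : V n) → (w ++ g) ✚ (w′ ++ g′) ≡ (w ✚ w′) ++ (g ✚ g′)
  ++-✚ w w′ g g′ = zipWith-++ _⊕_ w g w′ g′

  _≟ᵛ_ : ∀ {n} (x y : V n) → Dec (x ≡ y)
  _≟ᵛ_ = ≡-dec _≟ᶠ_

  abstract
    -- The coordinates of `W` are dropped one at a time. Only vectors that `α` keeps in `{0} × G`
    -- are controlled, which is all that `sameUnderAut` asks for.
    restrict³ : ∀ {r} (α : Automorphism (3 + r)) →
      Σ (Automorphism r) λ β → ∀ x y → to α (𝟎 {3} ++ x) ≡ 𝟎 {3} ++ y → to β x ≡ y
    restrict³ α =
      let (β₁ , h₁) = restrict α
          (β₂ , h₂) = restrict β₁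
          (β₃ , h₃) = restrict β₂
      in β₃ , λ x y eq → h₃ x y (h₂ (𝟘 ∷ x) (𝟘 ∷ y) (h₁ (𝟘 ∷ 𝟘 ∷ x) (𝟘 ∷ 𝟘 ∷ y) eq))

  -- Connection sets and the CI property.

  module _ {r : ℕ} (S : V r → Bool) where

    infix 4 _∈°
    -- Zero is removed so that the layers over `± eᵢ` omit it; membership of zero is compared
    -- separately, through loops.
    _∈° : V r → Set
    g ∈° = T (S g) × g ≢ 𝟎

    _∈°? : ∀ g → Dec (g ∈°)
    g ∈°? = T? (S g) ×-dec ¬? (g ≟ᵛ 𝟎)

  module CayleyGraphs {n : ℕ} where

    Γ : FiniteGroup 0ℓ 0ℓ
    Γ = ℤMod^ p n

    ⟦_⟧ˢ : {K : V n → Set} → (∀ x → Dec (K x)) → Subset Γ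
    ⟦ K? ⟧ˢ = record { to = λ x → ⌊ K? x ⌋ ; cong = cong (λ x → ⌊ K? x ⌋) }

    ∈⟦⟧ : {K : V n → Set} (K? : ∀ x → Dec (K x)) → ∀ {x} → _∈ˢ_ Γ x ⟦ K? ⟧ˢ ⇔ K x
    ∈⟦⟧ K? {x} = mk⇔ (toWitness {a? = K? x}) fromWitness

    -- The existential in `Cay` has a single candidate, the difference `y ─ x`; from here on only
    -- differences are compared.
    edge⇔ : (S : Subset Γ) → ∀ {x y} → Digraph._⟶_ (Cay Γ S) x y ⇔ _∈ˢ_ Γ (y ─ x) S
    edge⇔ S {x} {y} = mk⇔
      (λ (s , s∈S , y≡sx) → subst (λ z → _∈ˢ_ Γ z S)
        (sym (trans (cong (_─ x) y≡sx) (Vᵖ.//-rightDividesʳ x s))) s∈S)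
      (λ y-x∈S → y ─ x , y-x∈S , sym (Vᵖ.//-rightDividesˡ x y))

    -- All uses of the CI property pass through here. Decidable predicates replace characteristic
    -- functions, and the inverse of the automorphism is read off from surjectivity.
    ci⇒automorphism : IsCIGroup Γ →
      ∀ {K K′ : V n → Set} (K? : ∀ x → Dec (K x)) (K′? : ∀ x → Dec (K′ x)) →
      (∀ x → K x → K (⊝ x)) → (∀ x → K′ x → K′ (⊝ x)) →
      (φ : V n ↔ V n) → (∀ x y → K (y ─ x) ⇔ K′ (Inverse.to φ y ─ Inverse.to φ x)) →
      Σ (Automorphism n) λ α → ∀ x → K x ⇔ K′ (to α x)
    ci⇒automorphism ci {K} {K′} K? K′? K-sym K′-sym φ φ-edge = α , λ x → mk⇔
      (λ Kx → E.to (∈⟦⟧ K′?) (E.from (carries (a x)) (x , E.from (∈⟦⟧ K?) Kx , refl)))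
      (λ K′αx → let (x′ , x′∈K , αx≡αx′) = E.to (carries (a x)) (E.from (∈⟦⟧ K′?) K′αx)
                in subst K (sym (iso.injective αx≡αx′)) (E.to (∈⟦⟧ K?) x′∈K))
      where
      module E = Equivalence
      symmetric : ∀ {K : V n → Set} (K? : ∀ x → Dec (K x)) → (∀ x → K x → K (⊝ x)) → Symmetric Γ ⟦ K? ⟧ˢ
      symmetric {K} K? K-sym x = mk⇔
        (λ x∈ → E.from (∈⟦⟧ K?) (K-sym x (E.to (∈⟦⟧ K?) x∈)))
        (λ ⊝x∈ → E.from (∈⟦⟧ K?) (subst K (⁻¹-involutive x) (K-sym (⊝ x) (E.to (∈⟦⟧ K?) ⊝x∈))))
      iso≅ : Cay Γ ⟦ K? ⟧ˢ ≅ Cay Γ ⟦ K′? ⟧ˢ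
      iso≅ = φ , λ x y → mk⇔
        (E.from (edge⇔ ⟦ K′? ⟧ˢ) ∘ E.from (∈⟦⟧ K′?) ∘ E.to (φ-edge x y) ∘ E.to (∈⟦⟧ K?) ∘ E.to (edge⇔ ⟦ K? ⟧ˢ))
        (E.from (edge⇔ ⟦ K? ⟧ˢ) ∘ E.from (∈⟦⟧ K?) ∘ E.from (φ-edge x y) ∘ E.to (∈⟦⟧ K′?) ∘ E.to (edge⇔ ⟦ K′? ⟧ˢ))
      same : SameUnderAut Γ ⟦ K? ⟧ˢ ⟦ K′? ⟧ˢ
      same = ci ⟦ K? ⟧ˢ (symmetric K? K-sym) ⟦ K′? ⟧ˢ (symmetric K′? K′-sym) iso≅
      a : V n → V n
      a = proj₁ same
      carries : _[_]≐_ Γ a ⟦ K? ⟧ˢ ⟦ K′? ⟧ˢ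
      carries = proj₂ (proj₂ same)
      module iso = GroupMorphisms.IsGroupIsomorphism (proj₁ (proj₂ same))
      preimage : ∀ y → ∃[ x ] (a x ≡ y)
      preimage y = let (x , h) = iso.surjective y in x , h refl
      α : Automorphism n
      α = record
        { to = a ; from = proj₁ ∘ preimage ; to-✚ = iso.∙-homo
        ; to∘from = proj₂ ∘ preimage
        ; from∘to = λ x → iso.injective (proj₂ (preimage (a x))) }

  open CayleyGraphs

  -- Lifting the isomorphism to `W × G` and descending to `G`.

  module Reduction {r : ℕ} (S S′ : Subset (ℤMod^ p r)) (φ≅ : Cay (ℤMod^ p r) S ≅ Cay (ℤMod^ p r) S′) where

    private
      module E = Equivalence
      module φ = Inverse (proj₁ φ≅)

    φ-injective : ∀ {x y} → φ.to x ≡ φ.to y → x ≡ y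
    φ-injective {x} {y} eq = trans (sym (φ.strictlyInverseʳ x)) (trans (cong φ.from eq) (φ.strictlyInverseʳ y))

    φ-edge : ∀ x y → T (Func.to S (y ─ x)) ⇔ T (Func.to S′ (φ.to y ─ φ.to x))
    φ-edge x y = mk⇔
      (E.to (edge⇔ S′) ∘ E.to (proj₂ φ≅ x y) ∘ E.from (edge⇔ S))
      (E.to (edge⇔ S) ∘ E.from (proj₂ φ≅ x y) ∘ E.from (edge⇔ S′))

    φ-loop : ∀ x y → y ─ x ≡ 𝟎 ⇔ φ.to y ─ φ.to x ≡ 𝟎
    φ-loop x y = mk⇔
      (x≈y⇒x∙y⁻¹≈ε ∘ cong φ.to ∘ x∙y⁻¹≈ε⇒x≈y y x)
      (x≈y⇒x∙y⁻¹≈ε ∘ φ-injective ∘ x∙y⁻¹≈ε⇒x≈y (φ.to y) (φ.to x))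

    -- Removing zero from both sets deletes the loops, and a bijection preserves equality of
    -- endpoints.
    φ-edge° : ∀ x y → (_∈° (Func.to S) (y ─ x)) ⇔ (_∈° (Func.to S′) (φ.to y ─ φ.to x))
    φ-edge° x y = mk⇔
      (λ (e , ne) → E.to (φ-edge x y) e , ne ∘ E.from (φ-loop x y))
      (λ (e , ne) → E.from (φ-edge x y) e , ne ∘ E.to (φ-loop x y))

    Φ : V (3 + r) ↔ V (3 + r)
    Φ = mk↔ₛ′ (λ x → W x ++ φ.to (G x)) (λ x → W x ++ φ.from (G x))
      (λ { x@(a ∷ b ∷ c ∷ g) → cong (λ g → a ∷ b ∷ c ∷ g) (φ.strictlyInverseˡ g) })
      (λ { x@(a ∷ b ∷ c ∷ g) → cong (λ g → a ∷ b ∷ c ∷ g) (φ.strictlyInverseʳ g) })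

    W-Φ : ∀ x y → W (Inverse.to Φ y ─ Inverse.to Φ x) ≡ W (y ─ x)
    W-Φ (_ ∷ _ ∷ _ ∷ _) (_ ∷ _ ∷ _ ∷ _) = refl

    G-Φ : ∀ x y → G (Inverse.to Φ y ─ Inverse.to Φ x) ≡ φ.to (G y) ─ φ.to (G x)
    G-Φ (_ ∷ _ ∷ _ ∷ _) (_ ∷ _ ∷ _ ∷ _) = refl

    -- Matching the nonzero elements is enough: `γ` is corrected to an automorphism `β` of `G` that
    -- agrees with it on them, and `β` fixes zero.
    sameUnderAut : (γ : Automorphism (3 + r)) →
      (∀ {s} → _∈° (Func.to S) s → ∃[ t ] (_∈° (Func.to S′) t × to γ (𝟎 {3} ++ s) ≡ 𝟎 {3} ++ t)) →
      (∀ {t} → _∈° (Func.to S′) t → ∃[ s ] (_∈° (Func.to S) s × to γ (𝟎 {3} ++ s) ≡ 𝟎 {3} ++ t)) →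
      SameUnderAut (ℤMod^ p r) S S′
    sameUnderAut γ forth back = to β , isGroupIsomorphism β , λ y → mk⇔ (into y) (λ (x , x∈S , y≡βx) → subst (T ∘ Func.to S′) (sym y≡βx) (outof x x∈S))
      where
      β : Automorphism r
      β = proj₁ (restrict³ γ)
      β≡ : ∀ x y → to γ (𝟎 {3} ++ x) ≡ 𝟎 {3} ++ y → to β x ≡ y
      β≡ = proj₂ (restrict³ γ)
      -- The presence of a loop at `𝟎` decides whether zero belongs to the set, and `φ` preserves
      -- loops.
      𝟎∈⇔ : T (Func.to S 𝟎) ⇔ T (Func.to S′ 𝟎)
      𝟎∈⇔ = subst₂ (λ a b → T (Func.to S a) ⇔ T (Func.to S′ b)) (inverseʳ 𝟎) (inverseʳ (φ.to 𝟎)) (φ-edge 𝟎 𝟎)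
      into : ∀ y → T (Func.to S′ y) → ∃[ x ] (T (Func.to S x) × y ≡ to β x)
      into y y∈S′ with y ≟ᵛ 𝟎
      ... | yes refl = 𝟎 , E.from 𝟎∈⇔ y∈S′ , sym (to-𝟎 β)
      ... | no y≢𝟎 = let (s , (s∈S , _) , eq) = back (y∈S′ , y≢𝟎) in s , s∈S , sym (β≡ s y eq)
      outof : ∀ x → T (Func.to S x) → T (Func.to S′ (to β x))
      outof x x∈S with x ≟ᵛ 𝟎
      ... | yes refl = subst (T ∘ Func.to S′) (sym (to-𝟎 β)) (E.to 𝟎∈⇔ x∈S)
      ... | no x≢𝟎 = let (t , (t∈S′ , _) , eq) = forth (x∈S , x≢𝟎) in subst (T ∘ Func.to S′) (sym (β≡ x t eq)) t∈S′

  -- The case `p = 2`.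

  dci-even : p ≡ 2 → ∀ {r} → IsCIGroup (ℤMod^ p (3 + r)) → IsDCIGroup (ℤMod^ p r)
  dci-even p≡2 {r} ci S S′ φ≅ = sameUnderAut α forth back
    where
    open Reduction S S′ φ≅
    module E = Equivalence

    K : (V r → Bool) → V (3 + r) → Set
    K S x = W x ≡ 𝟎 × _∈° S (G x)

    K? : ∀ S x → Dec (K S x)
    K? S x = (W x ≟ᵛ 𝟎) ×-dec _∈°? S (G x)

    -- Since `2 = p` annihilates `x`, symmetry of the connection set is automatic.
    ⊝x≡x : ∀ {n} (x : V n) → ⊝ x ≡ x
    ⊝x≡x x = sym (Vᵖ.inverseˡ-unique x x
      (trans (cong (x ✚_) (sym (identityʳ x))) (subst (λ k → k • x ≡ 𝟎) p≡2 (p•≡𝟎 x))))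

    K-edge : ∀ x y → K (Func.to S) (y ─ x) ⇔ K (Func.to S′) (Inverse.to Φ y ─ Inverse.to Φ x)
    K-edge x y = mk⇔
      (λ (w , g) → trans (W-Φ x y) w , subst (_∈° (Func.to S′)) (sym (G-Φ x y))
        (E.to (φ-edge° (G x) (G y)) (subst (_∈° (Func.to S)) (G-─ y x) g)))
      (λ (w , g) → trans (sym (W-Φ x y)) w , subst (_∈° (Func.to S)) (sym (G-─ y x))
        (E.from (φ-edge° (G x) (G y)) (subst (_∈° (Func.to S′)) (G-Φ x y) g)))

    automorphism = ci⇒automorphism ci (K? (Func.to S)) (K? (Func.to S′))
      (λ x → subst (K (Func.to S)) (sym (⊝x≡x x))) (λ x → subst (K (Func.to S′)) (sym (⊝x≡x x))) Φ K-edge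

    α : Automorphism (3 + r)
    α = proj₁ automorphism

    forth : ∀ {s} → _∈° (Func.to S) s → ∃[ t ] (_∈° (Func.to S′) t × to α (𝟎 {3} ++ s) ≡ 𝟎 {3} ++ t)
    forth {s} s∈ = let (w , g) = E.to (proj₂ automorphism (𝟎 {3} ++ s)) (refl , s∈) in
      G (to α (𝟎 {3} ++ s)) , g , WG-ext w refl

    back : ∀ {t} → _∈° (Func.to S′) t → ∃[ s ] (_∈° (Func.to S) s × to α (𝟎 {3} ++ s) ≡ 𝟎 {3} ++ t)
    back {t} t∈ =
      let x = from α (𝟎 {3} ++ t)
          (w , g) = E.from (proj₂ automorphism x) (subst (K (Func.to S′)) (sym (to∘from α (𝟎 {3} ++ t))) (refl , t∈))
      in G x , g , trans (cong (to α) (WG-ext (sym w) refl)) (to∘from α (𝟎 {3} ++ t))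

  -- Integer coordinates and their reduction modulo `p`.

  ι : ℤ → Fin p
  ι (+ n)    = n mod p
  ι -[1+ n ] = ⊖ (suc n mod p)

  ι-⊖ : ∀ m n → ι (m ⊖ℤ n) ≡ (m mod p) ⊕ (⊖ (n mod p))
  ι-⊖ zero    zero    = sym (⊕-inverseʳ 𝟘)
  ι-⊖ zero    (suc n) = sym (⊕-identityˡ _)
  ι-⊖ (suc m) zero    = sym (trans (cong ((suc m mod p) ⊕_) (AbelianGroupProperties.ε⁻¹≈ε 𝔽)) (⊕-identityʳ _))
  ι-⊖ (suc m) (suc n) = begin
    ι (suc m ⊖ℤ suc n)                          ≡⟨ cong ι (ℤ.[1+m]⊖[1+n]≡m⊖n m n) ⟩
    ι (m ⊖ℤ n)                                  ≡⟨ ι-⊖ m n ⟩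
    a ⊕ (⊖ b)                                   ≡⟨ ⊕-identityˡ _ ⟨
    𝟘 ⊕ (a ⊕ (⊖ b))                             ≡⟨ cong (_⊕ (a ⊕ (⊖ b))) (⊕-inverseʳ 𝟙) ⟨
    (𝟙 ⊕ (⊖ 𝟙)) ⊕ (a ⊕ (⊖ b))                   ≡⟨ interchange 𝟙 (⊖ 𝟙) a (⊖ b) ⟩
    (𝟙 ⊕ a) ⊕ ((⊖ 𝟙) ⊕ (⊖ b))                   ≡⟨ cong ((𝟙 ⊕ a) ⊕_) (AbelianGroupProperties.⁻¹-∙-comm 𝔽 𝟙 b) ⟩
    (𝟙 ⊕ a) ⊕ (⊖ (𝟙 ⊕ b))                       ≡⟨ cong₂ (λ u v → u ⊕ (⊖ v)) (step m) (step n) ⟩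
    (suc m mod p) ⊕ (⊖ (suc n mod p))           ∎
    where
    open ≡-Reasoning
    open CommutativeSemigroupProperties (AbelianGroup.commutativeSemigroup 𝔽) using (interchange)
    a = m mod p
    b = n mod p
    step : ∀ k → 𝟙 ⊕ (k mod p) ≡ suc k mod p
    step k = trans (cong (𝟙 ⊕_) (sym (•𝟙 k))) (•𝟙 (suc k))

  mod-+ : ∀ m n → (m + n) mod p ≡ (m mod p) ⊕ (n mod p)
  mod-+ m n = trans (sym (•𝟙 (m + n))) (trans (F•.×-homo-+ 𝟙 m n) (cong₂ _⊕_ (•𝟙 m) (•𝟙 n)))

  ι-+ : ∀ k l → ι (k ℤ.+ l) ≡ ι k ⊕ ι l
  ι-+ (+ m)    (+ n)    = mod-+ m n
  ι-+ (+ m)    -[1+ n ] = ι-⊖ m (suc n)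
  ι-+ -[1+ m ] (+ n)    = trans (ι-⊖ n (suc m)) (⊕-comm (n mod p) (⊖ (suc m mod p)))
  ι-+ -[1+ m ] -[1+ n ] = trans
    (cong ⊖_ (trans (cong (_mod p) (sym (ℕ.+-suc (suc m) n))) (mod-+ (suc m) (suc n))))
    (sym (AbelianGroupProperties.⁻¹-∙-comm 𝔽 (suc m mod p) (suc n mod p)))

  ι-neg : ∀ k → ι (negateℤ k) ≡ ⊖ ι k
  ι-neg (+ zero)  = sym (AbelianGroupProperties.ε⁻¹≈ε 𝔽)
  ι-neg (+ suc n) = refl
  ι-neg -[1+ n ]  = sym (AbelianGroupProperties.⁻¹-involutive 𝔽 _)

  mod≡𝟘⇒∣ : ∀ n → n mod p ≡ 𝟘 → p ∣ n
  mod≡𝟘⇒∣ n eq = m%n≡0⇒n∣m n p (trans (sym (toℕ-mod n)) (trans (cong toℕ eq) toℕ𝟘))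

  ι≡𝟘⇒∣ : ∀ k → ι k ≡ 𝟘 → p ∣ ∣ k ∣
  ι≡𝟘⇒∣ (+ n)    eq = mod≡𝟘⇒∣ n eq
  ι≡𝟘⇒∣ -[1+ n ] eq = mod≡𝟘⇒∣ (suc n)
    (AbelianGroupProperties.⁻¹-injective 𝔽 (trans eq (sym (AbelianGroupProperties.ε⁻¹≈ε 𝔽))))

  infixl 6 _+ᶻ_ _-ᶻ_
  infix 8 -ᶻ_

  _+ᶻ_ _-ᶻ_ : ∀ {n} → Vec ℤ n → Vec ℤ n → Vec ℤ n
  _+ᶻ_ = zipWith ℤ._+_
  s -ᶻ t = s +ᶻ map negateℤ t

  -ᶻ_ : ∀ {n} → Vec ℤ n → Vec ℤ n
  -ᶻ_ = map negateℤ

  -- Integer representatives allow finite case distinctions to be settled by one computation,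
  -- uniformly in the prime.
  ⟦_⟧ : ∀ {n} → Vec ℤ n → V n
  ⟦_⟧ = map ι

  ⟦⟧-+ : ∀ {n} (s t : Vec ℤ n) → ⟦ s +ᶻ t ⟧ ≡ ⟦ s ⟧ ✚ ⟦ t ⟧
  ⟦⟧-+ []      []      = refl
  ⟦⟧-+ (k ∷ s) (l ∷ t) = cong₂ _∷_ (ι-+ k l) (⟦⟧-+ s t)

  ⟦⟧-neg : ∀ {n} (t : Vec ℤ n) → ⟦ -ᶻ t ⟧ ≡ ⊝ ⟦ t ⟧
  ⟦⟧-neg []      = refl
  ⟦⟧-neg (k ∷ t) = cong₂ _∷_ (ι-neg k) (⟦⟧-neg t)

  ⟦⟧-- : ∀ {n} (s t : Vec ℤ n) → ⟦ s -ᶻ t ⟧ ≡ ⟦ s ⟧ ─ ⟦ t ⟧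
  ⟦⟧-- s t = trans (⟦⟧-+ s (-ᶻ t)) (cong (⟦ s ⟧ ✚_) (⟦⟧-neg t))

  -- A coordinate k with ∣ k ∣ dividing 4 is nonzero modulo every odd prime; a coordinate ± 3
  -- does not count, since it vanishes for p = 3.
  Visible : ∀ {n} → Vec ℤ n → Set
  Visible = Any (λ k → ∣ k ∣ ∣ 4)

  visible? : ∀ {n} (t : Vec ℤ n) → Dec (Visible t)
  visible? = any? (λ k → ∣ k ∣ ∣? 4)

  -- The six vectors `± eᵢ`.

  coords : Fin 6 → Vec ℤ 3
  -- The order is `e₁, e₂, e₃, - e₃, - e₂, - e₁`, so that reversing the index with `opposite` is
  -- negation.
  coords = lookup
    ( ((+ 1) ∷ (+ 0) ∷ (+ 0) ∷ [])
    ∷ ((+ 0) ∷ (+ 1) ∷ (+ 0) ∷ [])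
    ∷ ((+ 0) ∷ (+ 0) ∷ (+ 1) ∷ [])
    ∷ ((+ 0) ∷ (+ 0) ∷ -[1+ 0 ] ∷ [])
    ∷ ((+ 0) ∷ -[1+ 0 ] ∷ (+ 0) ∷ [])
    ∷ (-[1+ 0 ] ∷ (+ 0) ∷ (+ 0) ∷ []) ∷ [])

  u : Fin 6 → V 3
  u d = ⟦ coords d ⟧

  u-opposite : ∀ d → u (opposite d) ≡ ⊝ u d
  u-opposite d = trans (cong ⟦_⟧ (coords-opposite d)) (⟦⟧-neg (coords d))
    where
    coords-opposite : ∀ d → coords (opposite d) ≡ -ᶻ coords d
    coords-opposite = toWitness {a? = all? λ d → ≡-dec ℤ._≟_ (coords (opposite d)) (-ᶻ coords d)} tt

  pos neg-pos : Fin 3 → Fin 6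
  pos i = i ↑ˡ 3
  neg-pos i = opposite (pos i)

  signed : ∀ d → (∃[ i ] d ≡ pos i) ⊎ (∃[ i ] d ≡ neg-pos i)
  signed zero                                = inj₁ (zero , refl)
  signed (suc zero)                          = inj₁ (suc zero , refl)
  signed (suc (suc zero))                    = inj₁ (suc (suc zero) , refl)
  signed (suc (suc (suc zero)))              = inj₂ (suc (suc zero) , refl)
  signed (suc (suc (suc (suc zero))))        = inj₂ (suc zero , refl)
  signed (suc (suc (suc (suc (suc zero)))))  = inj₂ (zero , refl)

  -- Relations among the six vectors for odd `p`.

  module Odd (p≢2 : p ≢ 2) where

    p∤2 : ¬ (p ∣ 2)
    p∤2 p∣2 = p≢2 (ℕ.≤-antisym (∣⇒≤ p∣2) 1<p)

    p∤4 : ¬ (p ∣ 4)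
    p∤4 p∣4 with euclidsLemma 2 2 pp p∣4
    ... | inj₁ p∣2 = p∤2 p∣2
    ... | inj₂ p∣2 = p∤2 p∣2

    visible⇒≢𝟎 : ∀ {n} {t : Vec ℤ n} → Visible t → ⟦ t ⟧ ≢ 𝟎
    visible⇒≢𝟎 (here {x = k} k∣4) eq = p∤4 (∣-trans (ι≡𝟘⇒∣ k (cong head eq)) k∣4)
    visible⇒≢𝟎 (there v)          eq = visible⇒≢𝟎 v (cong tail eq)

    invisible : ∀ {n} {t : Vec ℤ n} {P : Set} → Visible t ⊎ P → ⟦ t ⟧ ≡ 𝟎 → P
    invisible (inj₁ v) eq = contradiction eq (visible⇒≢𝟎 v)
    invisible (inj₂ x) eq = x

    -- The form in which the tables below are used: an entry either shows a difference that survives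
    -- modulo every odd prime, or already satisfies the conclusion `P`.
    distinguish : ∀ {n} (s t : Vec ℤ n) {P : Set} → Visible (s -ᶻ t) ⊎ P → ⟦ s ⟧ ≡ ⟦ t ⟧ → P
    distinguish s t h eq = invisible h (trans (⟦⟧-- s t) (x≈y⇒x∙y⁻¹≈ε eq))

    -- A nonzero coordinate could be cancelled, leaving `2 = 0` modulo the odd prime `p`.
    double≡𝟎 : ∀ {n} {x : V n} → x ✚ x ≡ 𝟎 → x ≡ 𝟎
    double≡𝟎 {x = []}    eq = refl
    double≡𝟎 {x = a ∷ x} eq = cong₂ _∷_ a≡𝟘 (double≡𝟎 (cong tail eq))
      where
      a≡𝟘 : a ≡ 𝟘
      a≡𝟘 with a ≟ᶠ 𝟘
      ... | yes a≡𝟘 = a≡𝟘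
      ... | no a≢𝟘 = contradiction (begin
        ι (+ 2)               ≡⟨ •𝟙 2 ⟨
        2 •ᶠ 𝟙                ≡⟨ cong (2 •ᶠ_) (proj₂ (inverse a≢𝟘)) ⟨
        2 •ᶠ m •ᶠ a           ≡⟨ •-•ᶠ-comm 2 m a ⟩
        m •ᶠ (a ⊕ (a ⊕ 𝟘))    ≡⟨ cong (λ c → m •ᶠ (a ⊕ c)) (⊕-identityʳ a) ⟩
        m •ᶠ (a ⊕ a)          ≡⟨ cong (m •ᶠ_) (cong head eq) ⟩
        m •ᶠ 𝟘                ≡⟨ •ᶠ-𝟘 m ⟩
        𝟘                     ∎) λ 2≡𝟘 → p∤2 (ι≡𝟘⇒∣ (+ 2) 2≡𝟘)
        where
        open ≡-Reasoning
        m = proj₁ (inverse a≢𝟘)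

    abstract
      u-injective : ∀ d f → u d ≡ u f → d ≡ f
      u-injective d f = distinguish (coords d) (coords f) (table d f)
        where
        table : ∀ d f → Visible (coords d -ᶻ coords f) ⊎ d ≡ f
        table = toWitness {a? = all? λ d → all? λ f →
          visible? (coords d -ᶻ coords f) ⊎-dec (d ≟ᶠ f)} tt

      u≢𝟎 : ∀ d → u d ≢ 𝟎
      u≢𝟎 d = visible⇒≢𝟎 (table d)
        where
        table : ∀ d → Visible (coords d)
        table = toWitness {a? = all? λ d → visible? (coords d)} tt

      -- Distinct members of `± eᵢ` sum to zero or to a vector with two nonzero coordinates. Equal
      -- ones must be allowed: for `p = 3`, `e + e` is `- e`.
      u-sum : ∀ d f a → u d ✚ u f ≡ u a → d ≡ f
      u-sum d f a eq = distinguish (coords d +ᶻ coords f) (coords a) (table d f a)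
        (trans (⟦⟧-+ (coords d) (coords f)) eq)
        where
        table : ∀ d f a → Visible (coords d +ᶻ coords f -ᶻ coords a) ⊎ d ≡ f
        table = toWitness {a? = all? λ d → all? λ f → all? λ a →
          visible? (coords d +ᶻ coords f -ᶻ coords a) ⊎-dec (d ≟ᶠ f)} tt

      -- Apart from zero sums, `± eᵢ` is a Sidon set. Separating `2 e` from `- 2 e` produces the
      -- coordinate 4, hence the divisors of 4 in `Visible`.
      u-sidon : ∀ a b c d → u a ✚ u b ≡ u c ✚ u d → a ≡ c ⊎ a ≡ d ⊎ a ≡ opposite b
      u-sidon a b c d eq = distinguish (coords a +ᶻ coords b) (coords c +ᶻ coords d) (table a b c d)
        (trans (⟦⟧-+ (coords a) (coords b)) (trans eq (sym (⟦⟧-+ (coords c) (coords d)))))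
        where
        table : ∀ a b c d → Visible (coords a +ᶻ coords b -ᶻ (coords c +ᶻ coords d)) ⊎ (a ≡ c ⊎ a ≡ d ⊎ a ≡ opposite b)
        table = toWitness {a? = all? λ a → all? λ b → all? λ c → all? λ d →
          visible? (coords a +ᶻ coords b -ᶻ (coords c +ᶻ coords d)) ⊎-dec
          ((a ≟ᶠ c) ⊎-dec ((a ≟ᶠ d) ⊎-dec (a ≟ᶠ opposite b)))} tt

      plus≢minus : ∀ i j → pos i ≢ neg-pos j
      plus≢minus = toWitness {a? = all? λ i → all? λ j → ¬? (pos i ≟ᶠ neg-pos j)} tt

      d≢opposite : ∀ (d : Fin 6) → d ≢ opposite d
      d≢opposite = toWitness {a? = all? λ d → ¬? (d ≟ᶠ opposite d)} tt

    -- The symmetric connection set `K`.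

    data Side (w : V 3) : Set where
      plus  : ∀ i → u (pos i) ≡ w → Side w
      minus : ∀ i → u (neg-pos i) ≡ w → Side w
      off   : (∀ d → u d ≢ w) → Side w

    abstract
      side : ∀ w → Side w
      side w with anyᶠ? (λ i → u (pos i) ≟ᵛ w) | anyᶠ? (λ i → u (neg-pos i) ≟ᵛ w)
      ... | yes (i , eq) | _            = plus i eq
      ... | no _         | yes (i , eq) = minus i eq
      ... | no ¬plus     | no ¬minus    = off ¬u
        where
        ¬u : ∀ d → u d ≢ w
        ¬u d eq with signed d
        ... | inj₁ (i , refl) = ¬plus (i , eq)
        ... | inj₂ (i , refl) = ¬minus (i , eq)

    module _ {r : ℕ} (S : V r → Bool) where

      -- The set over w ∈ V 3 in the connection set K below.
      Layer : ∀ {w} → Side w → V r → Set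
      Layer (plus _ _)  g = _∈° S g
      Layer (minus _ _) g = _∈° S (⊝ g)
      Layer (off _)     g = g ≡ 𝟎

      Layer? : ∀ {w} (σ : Side w) g → Dec (Layer σ g)
      Layer? (plus _ _)  g = _∈°? S g
      Layer? (minus _ _) g = _∈°? S (⊝ g)
      Layer? (off _)     g = g ≟ᵛ 𝟎

      -- The six vectors are distinct, so the three kinds of side exclude one another. The layer
      -- thus depends on `w` alone, and convenient evidence may replace the choice made by `side`.
      Layer-unique : ∀ {w} (σ τ : Side w) {g} → Layer σ g → Layer τ g
      Layer-unique (plus _ _)    (plus _ _)    h = h
      Layer-unique (plus i eq)   (minus j eq′) h = contradiction (u-injective (pos i) (neg-pos j) (trans eq (sym eq′))) (plus≢minus i j)
      Layer-unique (plus i eq)   (off ¬u)      h = contradiction eq (¬u (pos i))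
      Layer-unique (minus j eq′) (plus i eq)   h = contradiction (u-injective (pos i) (neg-pos j) (trans eq (sym eq′))) (plus≢minus i j)
      Layer-unique (minus _ _)   (minus _ _)   h = h
      Layer-unique (minus i eq)  (off ¬u)      h = contradiction eq (¬u (neg-pos i))
      Layer-unique (off ¬u)      (plus i eq)   h = contradiction eq (¬u (pos i))
      Layer-unique (off ¬u)      (minus i eq)  h = contradiction eq (¬u (neg-pos i))
      Layer-unique (off _)       (off _)       h = h

      K : V (3 + r) → Set
      K x = Layer (side (W x)) (G x)

      K? : ∀ x → Dec (K x)
      K? x = Layer? (side (W x)) (G x)

      K⇔Layer : ∀ {w} (σ : Side w) {g} → K (w ++ g) ⇔ Layer σ g
      K⇔Layer {w} σ {g} = subst₂ (λ w′ g′ → Layer (side w′) g′ ⇔ Layer σ g) (sym (W-++ w g)) (sym (G-++ w g))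
        (mk⇔ (Layer-unique (side w) σ) (Layer-unique σ (side w)))

      -- Layers off `± eᵢ` contain only zero, so a nonzero `G`-part confines the `W`-part to the six
      -- vectors.
      K-direction : ∀ x → K x → G x ≢ 𝟎 → ∃[ d ] u d ≡ W x
      K-direction x Kx Gx≢𝟎 with side (W x)
      ... | plus i eq  = pos i , eq
      ... | minus i eq = neg-pos i , eq
      ... | off _      = contradiction Kx Gx≢𝟎

      K-off : ∀ {w} → (∀ d → u d ≢ w) → K (w ++ 𝟎)
      K-off ¬u = Equivalence.from (K⇔Layer (off ¬u)) refl

      -- Together with `¬K-u`, this identifies the vectors `± eᵢ` as the complement of `K` inside
      -- `W × {0}`.
      ¬K⇒direction : ∀ {w} → ¬ K (w ++ 𝟎) → ∃[ d ] u d ≡ w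
      ¬K⇒direction {w} ¬K with side w
      ... | plus i eq  = pos i , eq
      ... | minus i eq = neg-pos i , eq
      ... | off ¬u     = contradiction (K-off ¬u) ¬K

      ¬K-u : ∀ d → ¬ K (u d ++ 𝟎)
      ¬K-u d K with signed d
      ... | inj₁ (i , refl) = proj₂ (Equivalence.to (K⇔Layer (plus i refl)) K) refl
      ... | inj₂ (i , refl) = proj₂ (Equivalence.to (K⇔Layer (minus i refl)) K) ε⁻¹≈ε

      K-sym : ∀ x → K x → K (⊝ x)
      K-sym x Kx = subst K
        (WG-ext {x = ⊝ W x ++ ⊝ G x} {⊝ x} (trans (W-++ (⊝ W x) (⊝ G x)) (sym (W-⊝ x))) (trans (G-++ (⊝ W x) (⊝ G x)) (sym (G-⊝ x))))
        (go (side (W x)) Kx)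
        where
        go : (σ : Side (W x)) → Layer σ (G x) → K (⊝ W x ++ ⊝ G x)
        go (plus i eq) h = Equivalence.from (K⇔Layer (minus i (trans (u-opposite (pos i)) (cong ⊝_ eq))))
          (subst (_∈° S) (sym (⁻¹-involutive (G x))) h)
        go (minus i eq) h = Equivalence.from
          (K⇔Layer (plus i (trans (sym (⁻¹-involutive (u (pos i)))) (cong ⊝_ (trans (sym (u-opposite (pos i))) eq))))) h
        go (off ¬u) h = Equivalence.from (K⇔Layer (off λ d eq → ¬u (opposite d)
          (trans (u-opposite d) (trans (cong ⊝_ eq) (⁻¹-involutive (W x)))))) (trans (cong ⊝_ h) ε⁻¹≈ε)

      -- An invariant of the pair (V (3 + r), K) that forces x into V 3.
      Central : V (3 + r) → Set
      Central x = K x × ∃[ y ] (K y × K (x ✚ y) × K (x ─ y) × y ≢ 𝟎 × y ≢ x × y ≢ ⊝ x)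

      sum-direction : ∀ x y d f → u d ≡ W x → u f ≡ W y → K (x ✚ y) → G (x ✚ y) ≢ 𝟎 → d ≡ f
      sum-direction x y d f ud uf K+ G+ = let (a , ua) = K-direction (x ✚ y) K+ G+ in
        u-sum d f a (trans (cong₂ _✚_ ud uf) (sym (trans ua (W-✚ x y))))

      difference-direction : ∀ x y d f → u d ≡ W x → u f ≡ W y → K (x ─ y) → G (x ─ y) ≢ 𝟎 → d ≡ opposite f
      difference-direction x y d f ud uf = sum-direction x (⊝ y) d (opposite f) ud
        (trans (u-opposite f) (trans (cong ⊝_ uf) (sym (W-⊝ y))))

      -- Both `x ✚ y` and `x ─ y` keep a nonzero `G`-part, so they lie over some `u a` and `u b`
      -- with `u a ✚ u b ≡ u d ✚ u d`. The Sidon property gives `a ≡ d`, because a zero sum would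
      -- force `u d` to vanish.
      horizontal : ∀ x y d → u d ≡ W x → G x ≢ 𝟎 → G y ≡ 𝟎 → K (x ✚ y) → K (x ─ y) → y ≡ 𝟎
      horizontal x y d ud≡Wx Gx≢𝟎 Gy≡𝟎 K+ K- = WG-ext (Wy≡𝟎) Gy≡𝟎
        where
        open ≡-Reasoning
        open CommutativeSemigroupProperties (AbelianGroup.commutativeSemigroup (𝕍 3)) using (interchange)
        G+ : G (x ✚ y) ≡ G x
        G+ = trans (G-✚ x y) (trans (cong (G x ✚_) Gy≡𝟎) (identityʳ (G x)))
        G- : G (x ─ y) ≡ G x
        G- = trans (G-─ x y) (trans (cong (λ g → G x ─ g) Gy≡𝟎) (trans (cong (G x ✚_) ε⁻¹≈ε) (identityʳ (G x))))
        +dir = K-direction (x ✚ y) K+ (λ eq → Gx≢𝟎 (trans (sym G+) eq))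
        -dir = K-direction (x ─ y) K- (λ eq → Gx≢𝟎 (trans (sym G-) eq))
        a = proj₁ +dir
        b = proj₁ -dir
        a+b≡d+d : u a ✚ u b ≡ u d ✚ u d
        a+b≡d+d = begin
          u a ✚ u b                         ≡⟨ cong₂ _✚_ (trans (proj₂ +dir) (W-✚ x y)) (trans (proj₂ -dir) (W-─ x y)) ⟩
          (W x ✚ W y) ✚ (W x ─ W y)         ≡⟨ interchange (W x) (W y) (W x) (⊝ W y) ⟩
          (W x ✚ W x) ✚ (W y ─ W y)         ≡⟨ cong ((W x ✚ W x) ✚_) (inverseʳ (W y)) ⟩
          (W x ✚ W x) ✚ 𝟎                   ≡⟨ identityʳ _ ⟩
          W x ✚ W x                         ≡⟨ cong₂ _✚_ ud≡Wx ud≡Wx ⟨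
          u d ✚ u d                         ∎
        a≡d : a ≡ d
        a≡d = [ id , [ id , (λ a≡-b → contradiction (double≡𝟎 (trans (sym a+b≡d+d)
          (trans (cong (_✚ u b) (trans (cong u a≡-b) (u-opposite b))) (inverseˡ (u b))))) (u≢𝟎 d)) ]′ ]′
          (u-sidon a b d d a+b≡d+d)
        Wy≡𝟎 : W y ≡ 𝟎
        Wy≡𝟎 = Vᵖ.identityʳ-unique (W x) (W y)
          (trans (sym (W-✚ x y)) (trans (sym (proj₂ +dir)) (trans (cong u a≡d) ud≡Wx)))

      -- Suppose `G x` is nonzero; `horizontal` excludes `G y ≡ 𝟎`. If both `x ✚ y` and `x ─ y` have
      -- zero `G`-part, then twice `G x` is zero; if exactly one does, `y` is `⊝ x` or `x`; if
      -- neither does, the directions of `x` and `y` are both equal and opposite.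
      central⇒G≡𝟎 : ∀ {x} → Central x → G x ≡ 𝟎
      central⇒G≡𝟎 {x} (Kx , y , Ky , K+ , K- , y≢𝟎 , y≢x , y≢⊝x) with G x ≟ᵛ 𝟎 | G y ≟ᵛ 𝟎
      ... | yes Gx≡𝟎 | _        = Gx≡𝟎
      ... | no Gx≢𝟎  | yes Gy≡𝟎 =
        contradiction (horizontal x y (proj₁ (K-direction x Kx Gx≢𝟎)) (proj₂ (K-direction x Kx Gx≢𝟎)) Gx≢𝟎 Gy≡𝟎 K+ K-) y≢𝟎
      ... | no Gx≢𝟎  | no Gy≢𝟎 = go (K-direction x Kx Gx≢𝟎) (K-direction y Ky Gy≢𝟎) (G (x ✚ y) ≟ᵛ 𝟎) (G (x ─ y) ≟ᵛ 𝟎)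
        where
        go : ∃[ d ] u d ≡ W x → ∃[ f ] u f ≡ W y → Dec (G (x ✚ y) ≡ 𝟎) → Dec (G (x ─ y) ≡ 𝟎) → G x ≡ 𝟎
        go _ _ (yes G+≡𝟎) (yes G-≡𝟎) = double≡𝟎 (trans
          (cong (G x ✚_) (x∙y⁻¹≈ε⇒x≈y (G x) (G y) (trans (sym (G-─ x y)) G-≡𝟎)))
          (trans (sym (G-✚ x y)) G+≡𝟎))
        go (d , ud) (f , uf) (yes G+≡𝟎) (no G-≢𝟎) = contradiction (WG-ext
          (begin
            W y             ≡⟨ uf ⟨
            u f             ≡⟨ ⁻¹-involutive (u f) ⟨
            ⊝ (⊝ u f)       ≡⟨ cong ⊝_ (u-opposite f) ⟨
            ⊝ u (opposite f) ≡⟨ cong (⊝_ ∘ u) (difference-direction x y d f ud uf K- G-≢𝟎) ⟨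
            ⊝ u d           ≡⟨ cong ⊝_ ud ⟩
            ⊝ W x           ≡⟨ W-⊝ x ⟨
            W (⊝ x)         ∎)
          (trans (Vᵖ.inverseʳ-unique (G x) (G y) (trans (sym (G-✚ x y)) G+≡𝟎)) (sym (G-⊝ x)))) y≢⊝x
          where open ≡-Reasoning
        go (d , ud) (f , uf) (no G+≢𝟎) (yes G-≡𝟎) = contradiction (WG-ext
          (trans (sym uf) (trans (cong u (sym (sum-direction x y d f ud uf K+ G+≢𝟎))) ud))
          (sym (x∙y⁻¹≈ε⇒x≈y (G x) (G y) (trans (sym (G-─ x y)) G-≡𝟎)))) y≢x
        go (d , ud) (f , uf) (no G+≢𝟎) (no G-≢𝟎) = contradiction
          (trans (sym (sum-direction x y d f ud uf K+ G+≢𝟎)) (difference-direction x y d f ud uf K- G-≢𝟎)) (d≢opposite f)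

    -- Central vectors that span `W`.

    infix 9 _⊕𝟎
    _⊕𝟎 : ∀ {r} → V 3 → V (3 + r)
    w ⊕𝟎 = w ++ 𝟎

    ⊕𝟎-✚ : ∀ {r} w w′ → (w ✚ w′) ⊕𝟎 ≡ w ⊕𝟎 ✚ _⊕𝟎 {r} w′
    ⊕𝟎-✚ w w′ = sym (trans (++-✚ w w′ 𝟎 𝟎) (cong ((w ✚ w′) ++_) (identityˡ 𝟎)))

    ⊕𝟎-⊝ : ∀ {r} w → (⊝ w) ⊕𝟎 ≡ ⊝ _⊕𝟎 {r} w
    ⊕𝟎-⊝ w = sym (trans (map-++ ⊖_ w 𝟎) (cong ((⊝ w) ++_) ε⁻¹≈ε))

    ⊕𝟎-injective : ∀ {r} {w w′} → _⊕𝟎 {r} w ≡ w′ ⊕𝟎 → w ≡ w′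
    ⊕𝟎-injective {r} {w} {w′} eq = trans (sym (W-++ w (𝟎 {r}))) (trans (cong W eq) (W-++ w′ 𝟎))

    Off : Vec ℤ 3 → Set
    Off s = ∀ d → Visible (coords d -ᶻ s)

    off? : ∀ s → Dec (Off s)
    off? s = all? λ d → visible? (coords d -ᶻ s)

    -- An integer certificate that `⟦ t ⟧` can serve as the `y` in `Central` for `⟦ s ⟧`, valid for
    -- every odd prime.
    Witness : Vec ℤ 3 → Vec ℤ 3 → Set
    Witness s t = Off s × Off t × Off (s +ᶻ t) × Off (s -ᶻ t) × Visible t × Visible (t -ᶻ s) × Visible (t -ᶻ (-ᶻ s))

    witness⇒central : ∀ {r} (S : V r → Bool) {s t} → Witness s t → Central S (⟦ s ⟧ ⊕𝟎)
    witness⇒central S {s} {t} (os , ot , os+t , os-t , vt , vt-s , vt+s) =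
      K-⟦⟧ os , ⟦ t ⟧ ⊕𝟎 , K-⟦⟧ ot
      , subst (K S) (trans (cong _⊕𝟎 (⟦⟧-+ s t)) (⊕𝟎-✚ ⟦ s ⟧ ⟦ t ⟧)) (K-⟦⟧ os+t)
      , subst (K S) (trans (cong _⊕𝟎 (⟦⟧-- s t)) (trans (⊕𝟎-✚ ⟦ s ⟧ (⊝ ⟦ t ⟧)) (cong (⟦ s ⟧ ⊕𝟎 ✚_) (⊕𝟎-⊝ ⟦ t ⟧)))) (K-⟦⟧ os-t)
      , (λ eq → visible⇒≢𝟎 vt (⊕𝟎-injective eq))
      , (λ eq → distinguish t s (inj₁ vt-s) (⊕𝟎-injective eq))
      , (λ eq → distinguish t (-ᶻ s) (inj₁ vt+s) (trans (⊕𝟎-injective (trans eq (sym (⊕𝟎-⊝ ⟦ s ⟧)))) (sym (⟦⟧-neg s))))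
      where
      K-⟦⟧ : ∀ {s} → Off s → K S (⟦ s ⟧ ⊕𝟎)
      K-⟦⟧ {s} os = K-off S λ d → distinguish (coords d) s (inj₁ (os d))

    others : Fin 3 → Fin 3 × Fin 3
    others zero             = suc zero , suc (suc zero)
    others (suc zero)       = zero , suc (suc zero)
    others (suc (suc zero)) = zero , suc zero

    pairSum : Fin 3 → Vec ℤ 3
    pairSum i = coords (pos (proj₁ (others i))) +ᶻ coords (pos (proj₂ (others i)))

    abstract
      -- Another pair sum serves as witness: the sum and difference of two of them are `(1, 1, 2)`
      -- and `(1, -1, 0)` up to order, with at least two coordinates nonzero modulo `p`, so neither
      -- is `± eᵢ`.
      pairSum-witness : ∀ i → Witness (pairSum i) (pairSum (proj₁ (others i)))
      pairSum-witness = toWitness {a? = all? λ i →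
        let s = pairSum i ; t = pairSum (proj₁ (others i)) in
        off? s ×-dec off? t ×-dec off? (s +ᶻ t) ×-dec off? (s -ᶻ t) ×-dec
        visible? t ×-dec visible? (t -ᶻ s) ×-dec visible? (t -ᶻ (-ᶻ s))} tt

      -- Since 2 is invertible modulo `p`, this shows that the pair sums span `W`.
      double-basis : ∀ i → let (j , k) = others i in
        coords (pos i) +ᶻ coords (pos i) ≡ pairSum j +ᶻ (pairSum k -ᶻ pairSum i)
      double-basis zero             = refl
      double-basis (suc zero)       = refl
      double-basis (suc (suc zero)) = refl

    basis-expansion : ∀ a b c → a ∷ b ∷ c ∷ [] ≡
      a · u (pos zero) ✚ (b · u (pos (suc zero)) ✚ c · u (pos (suc (suc zero))))
    basis-expansion a b c = sym (trans
      (cong₂ _✚_ (scale a 𝟙 𝟘 𝟘) (cong₂ _✚_ (scale b 𝟘 𝟙 𝟘) (scale c 𝟘 𝟘 𝟙)))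
      (cong₂ _∷_ (first a b c) (cong₂ _∷_ (second a b c) (cong₂ _∷_ (third a b c) refl))))
      where
      scale : ∀ k x y z → k · (x ∷ y ∷ z ∷ []) ≡ (toℕ k •ᶠ x) ∷ (toℕ k •ᶠ y) ∷ (toℕ k •ᶠ z) ∷ []
      scale k x y z = trans (•-∷ (toℕ k) x (y ∷ z ∷ [])) (cong ((toℕ k •ᶠ x) ∷_)
        (trans (•-∷ (toℕ k) y (z ∷ [])) (cong ((toℕ k •ᶠ y) ∷_)
        (trans (•-∷ (toℕ k) z []) (cong ((toℕ k •ᶠ z) ∷_) (•-𝟎 (toℕ k)))))))
      one = toℕ•𝟙
      nil : ∀ k → toℕ k •ᶠ 𝟘 ≡ 𝟘
      nil k = •ᶠ-𝟘 (toℕ k)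
      first : ∀ a b c → (toℕ a •ᶠ 𝟙) ⊕ ((toℕ b •ᶠ 𝟘) ⊕ (toℕ c •ᶠ 𝟘)) ≡ a
      first a b c = trans (cong₂ _⊕_ (one a) (trans (cong₂ _⊕_ (nil b) (nil c)) (⊕-identityˡ 𝟘))) (⊕-identityʳ a)
      second : ∀ a b c → (toℕ a •ᶠ 𝟘) ⊕ ((toℕ b •ᶠ 𝟙) ⊕ (toℕ c •ᶠ 𝟘)) ≡ b
      second a b c = trans (cong₂ _⊕_ (nil a) (trans (cong₂ _⊕_ (one b) (nil c)) (⊕-identityʳ b))) (⊕-identityˡ b)
      third : ∀ a b c → (toℕ a •ᶠ 𝟘) ⊕ ((toℕ b •ᶠ 𝟘) ⊕ (toℕ c •ᶠ 𝟙)) ≡ c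
      third a b c = trans (cong₂ _⊕_ (nil a) (trans (cong₂ _⊕_ (nil b) (one c)) (⊕-identityˡ c))) (⊕-identityˡ c)

    -- Invariance of `W × {0}` under `α`.

    module Axis {r : ℕ} (S S′ : V r → Bool) (α : Automorphism (3 + r))
                (K⇔K : ∀ x → K S x ⇔ K S′ (to α x)) where

      private module E = Equivalence

      central : ∀ {x} → Central S x → Central S′ (to α x)
      central {x} (Kx , y , Ky , K+ , K- , y≢𝟎 , y≢x , y≢⊝x) =
        E.to (K⇔K x) Kx , to α y , E.to (K⇔K y) Ky
        , subst (K S′) (to-✚ α x y) (E.to (K⇔K (x ✚ y)) K+)
        , subst (K S′) (trans (to-✚ α x (⊝ y)) (cong (to α x ✚_) (to-⊝ α y))) (E.to (K⇔K (x ─ y)) K-)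
        , (λ eq → y≢𝟎 (to-injective α (trans eq (sym (to-𝟎 α)))))
        , (λ eq → y≢x (to-injective α eq))
        , (λ eq → y≢⊝x (to-injective α (trans eq (sym (to-⊝ α x)))))

      -- The component of `α` from `W` to `G`; its vanishing means that `α` maps `W × {0}` into
      -- itself.
      A : V 3 → V r
      A w = G (to α (w ⊕𝟎))

      A-✚ : ∀ w w′ → A (w ✚ w′) ≡ A w ✚ A w′
      A-✚ w w′ = trans (cong (G ∘ to α) (⊕𝟎-✚ w w′))
        (trans (cong G (to-✚ α (w ⊕𝟎) (w′ ⊕𝟎))) (G-✚ (to α (w ⊕𝟎)) (to α (w′ ⊕𝟎))))

      open AdditiveMap (𝕍 3) (𝕍 r)

      A-pairSum : ∀ i → A ⟦ pairSum i ⟧ ≡ 𝟎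
      A-pairSum i = central⇒G≡𝟎 S′ (central (witness⇒central S (pairSum-witness i)))

      A-basis : ∀ i → A (u (pos i)) ≡ 𝟎
      A-basis i = double≡𝟎 (begin
        A (u (pos i)) ✚ A (u (pos i))              ≡⟨ A-✚ (u (pos i)) (u (pos i)) ⟨
        A (u (pos i) ✚ u (pos i))                  ≡⟨ cong A (⟦⟧-+ (coords (pos i)) (coords (pos i))) ⟨
        A ⟦ coords (pos i) +ᶻ coords (pos i) ⟧     ≡⟨ cong (A ∘ ⟦_⟧) (double-basis i) ⟩
        A ⟦ s +ᶻ (t -ᶻ pairSum i) ⟧                ≡⟨ cong A (trans (⟦⟧-+ s (t -ᶻ pairSum i)) (cong (⟦ s ⟧ ✚_) (⟦⟧-- t (pairSum i)))) ⟩
        A (⟦ s ⟧ ✚ (⟦ t ⟧ ─ ⟦ pairSum i ⟧))        ≡⟨ trans (A-✚ ⟦ s ⟧ _) (cong (A ⟦ s ⟧ ✚_) (A-✚ ⟦ t ⟧ _)) ⟩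
        A ⟦ s ⟧ ✚ (A ⟦ t ⟧ ✚ A (⊝ ⟦ pairSum i ⟧))  ≡⟨ cong₂ _✚_ (A-pairSum (proj₁ (others i))) (cong₂ _✚_ (A-pairSum (proj₂ (others i)))
                                                        (trans (⁻¹-homo (cong A) A-✚ ⟦ pairSum i ⟧) (cong ⊝_ (A-pairSum i)))) ⟩
        𝟎 ✚ (𝟎 ─ 𝟎)                                ≡⟨ trans (identityˡ _) (inverseʳ 𝟎) ⟩
        𝟎                                          ∎)
        where
        open ≡-Reasoning
        s = pairSum (proj₁ (others i))
        t = pairSum (proj₂ (others i))

      A≡𝟎 : ∀ w → A w ≡ 𝟎
      A≡𝟎 (a ∷ b ∷ c ∷ []) = trans (cong A (basis-expansion a b c)) (trans (A-✚ _ _)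
        (trans (cong₂ _✚_ (scaled a zero) (trans (A-✚ _ _) (trans (cong₂ _✚_ (scaled b (suc zero)) (scaled c (suc (suc zero)))) (identityˡ 𝟎))))
        (identityˡ 𝟎)))
        where
        scaled : ∀ k i → A (k · u (pos i)) ≡ 𝟎
        scaled k i = trans (×-homo (cong A) A-✚ (toℕ k) (u (pos i))) (trans (cong (toℕ k •_) (A-basis i)) (•-𝟎 (toℕ k)))

      image : ∀ w → to α (w ⊕𝟎) ≡ W (to α (w ⊕𝟎)) ⊕𝟎
      image w = WG-ext (sym (W-++ _ 𝟎)) (trans (A≡𝟎 w) (sym (G-++ (W (to α (w ⊕𝟎))) 𝟎)))

    -- The action of `α` on the basis of `W` and on `S°`.

    module Rigid {r : ℕ} (S S′ : V r → Bool) (α : Automorphism (3 + r))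
                 (K⇔K : ∀ x → K S x ⇔ K S′ (to α x)) where

      private module E = Equivalence

      K⇔K⁻¹ : ∀ y → K S′ y ⇔ K S (from α y)
      K⇔K⁻¹ y = mk⇔ (E.from (K⇔K (from α y)) ∘ subst (K S′) (sym (to∘from α y)))
                    (subst (K S′) (to∘from α y) ∘ E.to (K⇔K (from α y)))

      private
        module A = Axis S S′ α K⇔K
        module A⁻¹ = Axis S′ S (inv α) K⇔K⁻¹

      -- The vector `eᵢ` lies in `W × {0}` but outside `K`; `α` preserves both properties, and only
      -- the six vectors have them.
      basis-image : ∀ i → ∃[ d ] u d ≡ W (to α (u (pos i) ⊕𝟎))
      basis-image i = ¬K⇒direction S′ λ K′ →
        ¬K-u S (pos i) (E.from (K⇔K (u (pos i) ⊕𝟎)) (subst (K S′) (sym (A.image (u (pos i)))) K′))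

      f : Fin 3 → Fin 6
      f i = proj₁ (basis-image i)

      to-basis : ∀ i → to α (u (pos i) ⊕𝟎) ≡ u (f i) ⊕𝟎
      to-basis i = trans (A.image (u (pos i))) (cong _⊕𝟎 (sym (proj₂ (basis-image i))))

      f-injective : ∀ {i j} → f i ≡ f j → i ≡ j
      f-injective {i} {j} eq = ↑ˡ-injective 3 i j (u-injective (pos i) (pos j) (⊕𝟎-injective
        (to-injective α (trans (to-basis i) (trans (cong (λ d → u d ⊕𝟎) eq) (sym (to-basis j)))))))

      vertical : V r → V (3 + r)
      vertical g = 𝟎 {3} ++ g

      to-split : ∀ i g → to α (u (pos i) ++ g) ≡ to α (vertical g) ✚ u (f i) ⊕𝟎
      to-split i g = trans
        (cong (to α) (sym (trans (++-✚ 𝟎 (u (pos i)) g 𝟎) (cong₂ _++_ (identityˡ (u (pos i))) (identityʳ g)))))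
        (trans (to-✚ α (vertical g) (u (pos i) ⊕𝟎)) (cong (to α (vertical g) ✚_) (to-basis i)))

      G-to-split : ∀ i g → G (to α (u (pos i) ++ g)) ≡ G (to α (vertical g))
      G-to-split i g = trans (cong G (to-split i g)) (trans (G-✚ (to α (vertical g)) (u (f i) ⊕𝟎))
        (trans (cong (G (to α (vertical g)) ✚_) (G-++ (u (f i)) 𝟎)) (identityʳ _)))

      W-to-split : ∀ i g → W (to α (u (pos i) ++ g)) ≡ W (to α (vertical g)) ✚ u (f i)
      W-to-split i g = trans (cong W (to-split i g)) (trans (W-✚ (to α (vertical g)) (u (f i) ⊕𝟎))
        (cong (W (to α (vertical g)) ✚_) (W-++ (u (f i)) 𝟎)))

      -- Otherwise the image lies in `W × {0}`, which the inverse of `α` also preserves, and `g`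
      -- would vanish.
      G-vertical≢𝟎 : ∀ {g} → g ≢ 𝟎 → G (to α (vertical g)) ≢ 𝟎
      G-vertical≢𝟎 {g} g≢𝟎 G≡𝟎 = g≢𝟎 (begin
        g                                   ≡⟨ G-++ 𝟎 g ⟨
        G (vertical g)                      ≡⟨ cong G (from∘to α (vertical g)) ⟨
        G (from α (to α (vertical g)))      ≡⟨ cong (G ∘ from α) (WG-ext (sym (W-++ w 𝟎)) (trans G≡𝟎 (sym (G-++ w 𝟎)))) ⟩
        A⁻¹.A w                             ≡⟨ A⁻¹.A≡𝟎 w ⟩
        𝟎                                   ∎)
        where
        open ≡-Reasoning
        w = W (to α (vertical g))

      -- The displacement w of α over g satisfies w + u (f i) ∈ ± basis for all three i;
      -- since the u (f i) are distinct, the Sidon property leaves only w = 0.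
      W-vertical≡𝟎 : ∀ {g} → _∈° S g → W (to α (vertical g)) ≡ 𝟎
      W-vertical≡𝟎 {g} g∈@(_ , g≢𝟎) =
        [ id , (λ a≡-f₁ → [ id , (λ a≡-f₂ → contradiction
            (f-injective {suc zero} {suc (suc zero)} (opposite-injective (trans (sym a≡-f₁) a≡-f₂))) λ ()) ]′ (compare (suc (suc zero)) λ ())) ]′
          (compare (suc zero) λ ())
        where
        open ≡-Reasoning
        open CommutativeSemigroupProperties (AbelianGroup.commutativeSemigroup (𝕍 3)) using (xy∙z≈xz∙y)
        w = W (to α (vertical g))

        shifted : ∀ i → ∃[ a ] u a ≡ w ✚ u (f i)
        shifted i = let (a , ua) = K-direction S′ (to α (u (pos i) ++ g))
                          (E.to (K⇔K (u (pos i) ++ g)) (E.from (K⇔Layer S (plus i refl)) g∈))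
                          (λ eq → G-vertical≢𝟎 g≢𝟎 (trans (sym (G-to-split i g)) eq))
                    in a , trans ua (W-to-split i g)

        a : Fin 3 → Fin 6
        a i = proj₁ (shifted i)

        opposite-injective : ∀ {i j : Fin 6} → opposite i ≡ opposite j → i ≡ j
        opposite-injective {i} {j} eq = trans (sym (opposite-involutive i)) (trans (cong opposite eq) (opposite-involutive j))

        crossed : ∀ i → u (a zero) ✚ u (f i) ≡ u (a i) ✚ u (f zero)
        crossed i = begin
          u (a zero) ✚ u (f i)           ≡⟨ cong (_✚ u (f i)) (proj₂ (shifted zero)) ⟩
          (w ✚ u (f zero)) ✚ u (f i)     ≡⟨ xy∙z≈xz∙y w (u (f zero)) (u (f i)) ⟩
          (w ✚ u (f i)) ✚ u (f zero)     ≡⟨ cong (_✚ u (f zero)) (proj₂ (shifted i)) ⟨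
          u (a i) ✚ u (f zero)           ∎

        compare : ∀ i → zero ≢ i → w ≡ 𝟎 ⊎ a zero ≡ opposite (f i)
        compare i 0≢i =
          -- Of the three Sidon alternatives, the first cancels to `f i ≡ f zero`, the second gives
          -- `w ≡ 𝟎`, and the third is passed on; holding for both other indices, it would
          -- contradict injectivity of `f`.
          [ (λ a₀≡aᵢ → contradiction (f-injective (sym (u-injective (f i) (f zero)
              (Vᵖ.∙-cancelˡ (u (a zero)) _ _ (trans (crossed i) (cong (λ b → u b ✚ u (f zero)) (sym a₀≡aᵢ))))))) 0≢i)
          , [ (λ a₀≡f₀ → inj₁ (Vᵖ.identityˡ-unique w (u (f zero)) (trans (sym (proj₂ (shifted zero))) (cong u a₀≡f₀))))
            , inj₂ ]′ ]′
          (u-sidon (a zero) (f i) (a i) (f zero) (crossed i))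

      to-vertical : ∀ {g} → _∈° S g → to α (vertical g) ≡ vertical (G (to α (vertical g)))
      to-vertical g∈ = WG-ext (W-vertical≡𝟎 g∈) refl

      to-layer : ∀ {g h} → to α (vertical g) ≡ vertical h → to α (u (pos zero) ++ g) ≡ u (f zero) ++ h
      to-layer {g} {h} eq = trans (to-split zero g) (trans (cong (_✚ u (f zero) ⊕𝟎) eq)
        (trans (++-✚ 𝟎 (u (f zero)) h 𝟎) (cong₂ _++_ (identityˡ (u (f zero))) (identityʳ h))))

      -- Compares the layer of `S` over `e₁` with that of `S′` over the image of `e₁`; the sign of
      -- `f zero` decides whether the latter is `S′` or its negative, without zero.
      layer⇔ : ∀ {g h} → to α (vertical g) ≡ vertical h → _∈° S g ⇔ K S′ (u (f zero) ++ h)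
      layer⇔ {g} {h} eq = mk⇔
        (λ g∈ → subst (K S′) (to-layer eq) (E.to (K⇔K _) (E.from (K⇔Layer S (plus zero refl)) g∈)))
        (λ K′ → E.to (K⇔Layer S (plus zero refl)) (E.from (K⇔K _) (subst (K S′) (sym (to-layer eq)) K′)))

    -- Choosing between `α` and its negative.

    module UpToSign {r : ℕ} (S S′ : V r → Bool) (α : Automorphism (3 + r))
                      (K⇔K : ∀ x → K S x ⇔ K S′ (to α x)) where

      private
        module E = Equivalence
        module R = Rigid S S′ α K⇔K
        module R⁻¹ = Rigid S′ S (inv α) R.K⇔K⁻¹
      open R using (vertical)

      ⊝-vertical : ∀ g → ⊝ vertical g ≡ vertical (⊝ g)
      ⊝-vertical g = trans (map-++ ⊖_ 𝟎 g) (cong (_++ ⊝ g) ε⁻¹≈ε)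

      to-preimage : ∀ {t} → _∈° S′ t → to α (vertical (G (from α (vertical t)))) ≡ vertical t
      to-preimage {t} t∈ = trans (cong (to α) (sym (R⁻¹.to-vertical t∈))) (to∘from α (vertical t))

      Conjugator : Set
      Conjugator = Σ (Automorphism (3 + r)) λ γ →
        (∀ {s} → _∈° S s → ∃[ t ] (_∈° S′ t × to γ (vertical s) ≡ vertical t)) ×
        (∀ {t} → _∈° S′ t → ∃[ s ] (_∈° S s × to γ (vertical s) ≡ vertical t))

      conjugator : Conjugator
      conjugator = [ upright , inverted ]′ (signed (R.f zero))
        where
        upright : ∃[ j ] R.f zero ≡ pos j → Conjugator
        upright (j , f≡+) = α
          , (λ s∈ → _ , E.to (K⇔Layer S′ (plus j (sym (cong u f≡+)))) (E.to (R.layer⇔ (R.to-vertical s∈)) s∈) , R.to-vertical s∈)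
          , (λ t∈ → _ , E.from (R.layer⇔ (to-preimage t∈)) (E.from (K⇔Layer S′ (plus j (sym (cong u f≡+)))) t∈) , to-preimage t∈)
        inverted : ∃[ j ] R.f zero ≡ neg-pos j → Conjugator
        inverted (j , f≡-) = neg α
          , (λ s∈ → _ , E.to (K⇔Layer S′ (minus j (sym (cong u f≡-)))) (E.to (R.layer⇔ (R.to-vertical s∈)) s∈)
                    , trans (cong ⊝_ (R.to-vertical s∈)) (⊝-vertical _))
          , λ {t} t∈ →
              -- As `α` sends `s` to `t`, `neg α` sends `⊝ s` to `t`; it is `⊝ s` that belongs to
              -- `S`, because layers over `- eⱼ` are negated.
              let s = G (from α (vertical t))
                  eq : to α (vertical (⊝ s)) ≡ vertical (⊝ t)
                  eq = trans (cong (to α) (sym (⊝-vertical s))) (trans (to-⊝ α (vertical s))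
                         (trans (cong ⊝_ (to-preimage t∈)) (⊝-vertical t)))
              in ⊝ s
                 , E.from (R.layer⇔ eq) (E.from (K⇔Layer S′ (minus j (sym (cong u f≡-))))
                     (subst (_∈° S′) (sym (⁻¹-involutive t)) t∈))
                 , trans (cong ⊝_ eq) (trans (⊝-vertical (⊝ t)) (cong vertical (⁻¹-involutive t)))

    -- The case of odd `p` and the conclusion.

    dci-odd : ∀ {r} → IsCIGroup (ℤMod^ p (3 + r)) → IsDCIGroup (ℤMod^ p r)
    dci-odd {r} ci S S′ φ≅ = let (γ , forth , back) = UpToSign.conjugator S° S′° (proj₁ auto) (proj₂ auto)
                             in sameUnderAut γ forth back
      where
      open Reduction S S′ φ≅
      module E = Equivalence
      -- This is the characteristic function of all of `S`; zero is removed inside `Layer`.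
      S° = Func.to S
      S′° = Func.to S′
      φ = Inverse.to (proj₁ φ≅)

      -- The three kinds of layer express edges, reversed edges and equality of endpoints, and `φ`
      -- respects each.
      Layer-edge : ∀ {w} (σ : Side w) g h → Layer S° σ (h ─ g) ⇔ Layer S′° σ (φ h ─ φ g)
      Layer-edge (plus _ _)  g h = φ-edge° g h
      Layer-edge (minus _ _) g h = subst₂ (λ a b → _∈° S° a ⇔ _∈° S′° b)
        (sym (Vᵖ.⁻¹-anti-homo‿- h g)) (sym (Vᵖ.⁻¹-anti-homo‿- (φ h) (φ g))) (φ-edge° h g)
      Layer-edge (off _)     g h = φ-loop g h

      K-edge : ∀ x y → K S° (y ─ x) ⇔ K S′° (Inverse.to Φ y ─ Inverse.to Φ x)
      K-edge x y = subst₂ (λ g K′ → Layer S° (side (W (y ─ x))) g ⇔ K′) (sym (G-─ y x))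
        (cong₂ (λ w g → Layer S′° (side w) g) (sym (W-Φ x y)) (sym (G-Φ x y)))
        (Layer-edge (side (W (y ─ x))) (G x) (G y))

      auto : Σ (Automorphism (3 + r)) λ α → ∀ x → K S° x ⇔ K S′° (to α x)
      auto = ci⇒automorphism ci (K? S°) (K? S′°) (K-sym S°) (K-sym S′°) Φ K-edge

  ci⇒dci : ∀ {r} → IsCIGroup (ℤMod^ p (3 + r)) → IsDCIGroup (ℤMod^ p r)
  ci⇒dci with p ℕ.≟ 2
  ... | yes p≡2 = dci-even p≡2
  ... | no p≢2  = Odd.dci-odd p≢2

theorem1p1 : (p : ℕ) (pp : Prime p) (r : ℕ) →
    ¬ IsDCIGroup (ℤMod^ p {{prime⇒nonZero pp}} r) →
    ¬ IsCIGroup (ℤMod^ p {{prime⇒nonZero pp}} (r + 3))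
theorem1p1 p pp r ¬dci ci = ¬dci (ElementaryAbelian.ci⇒dci p pp
  -- `W` occupies the first three coordinates, so the dimension `r + 3` is rewritten as `3 + r`.
  (subst (λ n → IsCIGroup (ℤMod^ p {{prime⇒nonZero pp}} n)) (ℕ.+-comm r 3) ci))
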